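{- Fix $k\ge 3$. Assume that computing $\#1\mathrm{Fact}_{\mathrm{lab}}(B)$ is \#P-hard already on the class of $k$-regular bipartite multigraphs $B=(U,W,E)$ such that $|U|=|W|=p$ is prime and the associated directed multigraph $H_B$ is strongly connected. Then computing \[ G\longmapsto \#\mathrm{NSC}(G) \] is \#P-hard on the class of strongly connected Eulerian $k$-out graphs with a prime number of vertices. Consequently, under this assumption, the problem is \#P-complete on that class.
   Context: A graph is a finite directed multigraph $G=(V,E,s,t)$ with source and target maps $s,t:E\to V$ (loops and parallel edges allowed). It is $k$-out if every vertex has exactly $k$ outgoing edges; a $k$-out graph is Eulerian if every vertex also has exactly $k$ incoming edges. A coloring of a $k$-out graph $G$ is a map $\chi:E\to[k]=\{1,\dots,k\}$ whose restriction to the set of outgoing edges of each vertex is a bijection onto $[k]$. It defines the deterministic complete automaton $\chi(G)=(V,[k],\delta_\chi)$, where $\delta_\chi(v,a)=t(e)$ for the unique edge $e$ with $s(e)=v$, $\chi(e)=a$. The automaton is synchronizing if there is a word $w\in[k]^*$ with $|V\cdot w|=1$. $\#\mathrm{NSC}(G)$ is the number of colorings $\chi$ of $G$ for which $\chi(G)$ is not synchronizing. For a $k$-regular bipartite (undirected) multigraph $B=(U,W,E)$ with $|U|=|W|$, a labeled $1$-factorization is an ordered $k$-tuple $(M_1,\dots,M_k)$ of pairwise edge-disjoint perfect matchings whose union is $E$; $\#1\mathrm{Fact}_{\mathrm{lab}}(B)$ is the number of labeled $1$-factorizations of $B$. Writing $U=\{u_1,\dots,u_m\}$, $W=\{w_1,\dots,w_m\}$,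 the directed multigraph $H_B$ has vertex set $\{v_1,\dots,v_m\}$ and, for every edge of $B$ with endpoints $u_i$ and $w_j$ (counted with multiplicity), one directed edge from $v_i$ to $v_j$. -}

module Defs where

open import Data.Bool.Base using (Bool; true; false)
open import Data.Empty using (⊥)
open import Data.Fin.Base as Fin using (Fin; zero; suc; toℕ; funToFin; finToFun)
import Data.Fin.Properties as Fin
open import Data.Fin.Subset as Subset using (Subset; ⁅_⁆; ⋃; _∩_; ∣_∣; _∈_; ⊤)
open import Data.Fin.Subset.Properties using (_∈?_)
open import Data.Digit using (toNatDigits)
open import Data.List.Base as List
  using (List; []; _∷_; _++_; length; map; foldl; filter; filterᵇ; replicate;
         concatMap; cartesianProductWith; allFin; take; drop)
open import Data.List.Properties
  using (map-cong; foldl-++; length-++; length-take; length-drop; take++drop≡id;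
         ++-assoc; ∷-injectiveʳ)
open import Data.Nat.Base
  using (ℕ; zero; suc; _+_; _*_; _^_; _∸_; _⊓_; _≤_; _<_; z≤n; s≤s)
import Data.Nat.Properties as ℕ
open import Data.Nat.Induction using (<-wellFounded)
open import Data.Nat.Primality using (Prime)
open import Data.Product.Base using (Σ; ∃; ∃₂; _×_; _,_; proj₁; proj₂)
open import Data.Vec.Base as Vec using (Vec; []; _∷_; lookup; toList; count)
import Data.Vec.Properties as Vec
open import Function.Base using (_∘_)
open import Function.Bundles using (_↔_)
open import Induction.WellFounded using (Acc; acc)
open import Relation.Binary.Construct.Closure.ReflexiveTransitive using (Star)
open import Relation.Binary.PropositionalEquality
  using (_≡_; _≢_; refl; sym; trans; cong; cong₂; subst; _≗_; module ≡-Reasoning)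
open import Relation.Nullary using (¬_; Dec; yes; no)
open import Relation.Nullary.Decidable
  using (does; ¬?; _×-dec_; _→-dec_; map′)
open import Relation.Nullary.Negation using (contradiction)
open import Relation.Unary using (Decidable)

allVecs : {A : Set} → List A → ∀ n → List (Vec A n)
allVecs xs zero    = [] ∷ []
allVecs xs (suc n) = cartesianProductWith _∷_ xs (allVecs xs n)

allBits : ∀ n → List (Vec Bool n)
allBits = allVecs (true ∷ false ∷ [])

ExactlyOne : ∀ {n} → (Fin n → Set) → Set
ExactlyOne P = ∃ λ x → P x × (∀ y → P y → y ≡ x)

exactlyOne? : ∀ {n} {P : Fin n → Set} → Decidable P → Dec (ExactlyOne P)
exactlyOne? P? =
  Fin.any? λ x → P? x ×-dec Fin.all? λ y → P? y →-dec (y Fin.≟ x)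

-- The edge e runs from the first to the second component of lookup ends e;
-- equal pairs at different positions are parallel edges.
record Digraph : Set where
  field
    #V   : ℕ
    #E   : ℕ
    ends : Vec (Fin #V × Fin #V) #E

  V : Set
  V = Fin #V

  E : Set
  E = Fin #E

  src : E → V
  src e = proj₁ (lookup ends e)

  tgt : E → V
  tgt e = proj₂ (lookup ends e)

  outdegree : V → ℕ
  outdegree v = count (λ e → proj₁ e Fin.≟ v) ends

  indegree : V → ℕ
  indegree v = count (λ e → proj₂ e Fin.≟ v) ends

open Digraph

IsOut : ℕ → Digraph → Set
IsOut k G = ∀ v → outdegree G v ≡ k

IsEulerian : ℕ → Digraph → Set
IsEulerian k G = IsOut k G × (∀ v → indegree G v ≡ k)

StronglyConnected : Digraph → Set
StronglyConnected G = ∀ u v → Star Adjacent u v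
  where
  Adjacent : V G → V G → Set
  Adjacent u v = ∃ λ e → src G e ≡ u × tgt G e ≡ v

Transition : ℕ → ℕ → Set
Transition n k = Fin n → Fin k → Fin n

run : ∀ {n k} → Transition n k → List (Fin k) → Fin n → Fin n
run δ w v = foldl δ v w

image : ∀ {m n} → (Fin m → Fin n) → Subset n
image {m} f = ⋃ (map (λ v → ⁅ f v ⁆) (allFin m))

Synchronizing : ∀ {n k} → Transition n k → Set
Synchronizing δ = ∃ λ w → ∣ image (run δ w) ∣ ≡ 1

image-cong : ∀ {m n} {f g : Fin m → Fin n} → f ≗ g → image f ≡ image g
image-cong {m} f≗g = cong ⋃ (map-cong (λ v → cong ⁅_⁆ (f≗g v)) (allFin m))

foldl-cong : ∀ {n k} {δ δ′ : Transition n k} → (∀ v a → δ v a ≡ δ′ v a) →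
             ∀ w → run δ w ≗ run δ′ w
foldl-cong eq []      v = refl
foldl-cong {δ′ = δ′} eq (a ∷ w) v =
  trans (foldl-cong eq w _) (cong (run δ′ w) (eq v a))

synchronizing-cong : ∀ {n k} {δ δ′ : Transition n k} →
                     (∀ v a → δ v a ≡ δ′ v a) →
                     Synchronizing δ → Synchronizing δ′
synchronizing-cong eq (w , sync) =
  w , trans (cong ∣_∣ (sym (image-cong (foldl-cong eq w)))) sync

-- Synchronizability is decidable: there are n ^ n maps Fin n → Fin n, so a
-- word of length at least n ^ n has two prefixes acting identically and the
-- segment between them can be cut out.

module _ {n k : ℕ} (δ : Transition n k) where

  private
    shortcut : ∀ w → n ^ n ≤ length w →
               ∃ λ w′ → length w′ < length w × run δ w′ ≗ run δ w
    shortcut w long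
      with i , j , i<j , same ← Fin.pigeonhole (ℕ.n<1+n (n ^ n))
             (λ i → funToFin (run δ (take (toℕ i) w)))
      = take (toℕ i) w ++ drop (toℕ j) w , shorter , agrees
      where
      j≤ : toℕ j ≤ length w
      j≤ = ℕ.≤-trans (Fin.toℕ≤pred[n] j) long

      shorter : length (take (toℕ i) w ++ drop (toℕ j) w) < length w
      shorter = begin-strict
        length (take (toℕ i) w ++ drop (toℕ j) w)
          ≡⟨ length-++ (take (toℕ i) w) ⟩
        length (take (toℕ i) w) + length (drop (toℕ j) w)
          ≡⟨ cong₂ _+_ (length-take (toℕ i) w) (length-drop (toℕ j) w) ⟩
        toℕ i ⊓ length w + (length w ∸ toℕ j)
          ≤⟨ ℕ.+-monoˡ-≤ _ (ℕ.m⊓n≤m (toℕ i) (length w)) ⟩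
        toℕ i + (length w ∸ toℕ j)
          <⟨ ℕ.+-monoˡ-< _ i<j ⟩
        toℕ j + (length w ∸ toℕ j)
          ≡⟨ ℕ.m+[n∸m]≡n j≤ ⟩
        length w ∎
        where open ℕ.≤-Reasoning

      prefixes : run δ (take (toℕ i) w) ≗ run δ (take (toℕ j) w)
      prefixes v = begin
        run δ (take (toℕ i) w) v
          ≡⟨ sym (Fin.finToFun-funToFin _ v) ⟩
        finToFun (funToFin (run δ (take (toℕ i) w))) v
          ≡⟨ cong (λ c → finToFun c v) same ⟩
        finToFun (funToFin (run δ (take (toℕ j) w))) v
          ≡⟨ Fin.finToFun-funToFin _ v ⟩
        run δ (take (toℕ j) w) v ∎
        where open ≡-Reasoning

      agrees : run δ (take (toℕ i) w ++ drop (toℕ j) w) ≗ run δ w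
      agrees v = begin
        run δ (take (toℕ i) w ++ drop (toℕ j) w) v
          ≡⟨ foldl-++ δ v (take (toℕ i) w) (drop (toℕ j) w) ⟩
        run δ (drop (toℕ j) w) (run δ (take (toℕ i) w) v)
          ≡⟨ cong (run δ (drop (toℕ j) w)) (prefixes v) ⟩
        run δ (drop (toℕ j) w) (run δ (take (toℕ j) w) v)
          ≡⟨ sym (foldl-++ δ v (take (toℕ j) w) (drop (toℕ j) w)) ⟩
        run δ (take (toℕ j) w ++ drop (toℕ j) w) v
          ≡⟨ cong (λ u → run δ u v) (take++drop≡id (toℕ j) w) ⟩
        run δ w v ∎
        where open ≡-Reasoning

    shorten : ∀ w → Acc _<_ (length w) →
              ∃ λ w′ → length w′ ≤ n ^ n × run δ w′ ≗ run δ w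
    shorten w (acc rec) with n ^ n ℕ.≤? length w
    ... | no short = w , ℕ.<⇒≤ (ℕ.≰⇒> short) , λ _ → refl
    ... | yes long with w₁ , w₁< , eq₁ ← shortcut w long
                   with w₂ , w₂≤ , eq₂ ← shorten w₁ (rec w₁<)
                   = w₂ , w₂≤ , λ v → trans (eq₂ v) (eq₁ v)

    boundedWord? : ∀ l {P : List (Fin k) → Set} → Decidable P →
                   Dec (∃ λ w → length w ≤ l × P w)
    boundedWord? l P? with P? []
    ... | yes p = yes ([] , z≤n , p)
    boundedWord? zero P? | no ¬p = no λ { ([] , _ , p) → ¬p p }
    boundedWord? (suc l) P? | no ¬p =
      map′ (λ { (a , w , w≤ , p) → a ∷ w , s≤s w≤ , p })
           (λ { ([] , _ , p) → contradiction p ¬p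
              ; (a ∷ w , s≤s w≤ , p) → a , w , w≤ , p })
           (Fin.any? λ a → boundedWord? l (λ w → P? (a ∷ w)))

  synchronizing? : Dec (Synchronizing δ)
  synchronizing? =
    map′ (λ { (w , _ , sync) → w , sync })
         (λ { (w , sync) →
              let w′ , w′≤ , eq = shorten w (<-wellFounded (length w)) in
              w′ , w′≤ , trans (cong ∣_∣ (image-cong eq)) sync })
         (boundedWord? (n ^ n) (λ w → ∣ image (run δ w) ∣ ℕ.≟ 1))

module _ {k : ℕ} (G : Digraph) where

  private
    Assignment : Set
    Assignment = Vec (Fin k) (#E G)

  InjectiveOnOut : Assignment → Set
  InjectiveOnOut χ =
    ∀ e e′ → src G e ≡ src G e′ → lookup χ e ≡ lookup χ e′ → e ≡ e′

  SurjectiveOnOut : Assignment → Set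
  SurjectiveOnOut χ = ∀ v a → ∃ λ e → src G e ≡ v × lookup χ e ≡ a

  IsColoring : Assignment → Set
  IsColoring χ = InjectiveOnOut χ × SurjectiveOnOut χ

  automaton : (χ : Assignment) → IsColoring χ → Transition (#V G) k
  automaton χ (_ , surj) v a = tgt G (proj₁ (surj v a))

  NonSynchronizingColoring : Assignment → Set
  NonSynchronizingColoring χ =
    Σ (IsColoring χ) λ c → ¬ Synchronizing (automaton χ c)

  coloring? : Decidable IsColoring
  coloring? χ =
    (Fin.all? λ e → Fin.all? λ e′ →
      (src G e Fin.≟ src G e′) →-dec
      ((lookup χ e Fin.≟ lookup χ e′) →-dec (e Fin.≟ e′)))
    ×-dec
    (Fin.all? λ v → Fin.all? λ a → Fin.any? λ e →
      (src G e Fin.≟ v) ×-dec (lookup χ e Fin.≟ a))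

  automaton-unique : ∀ χ (c c′ : IsColoring χ) v a →
                     automaton χ c v a ≡ automaton χ c′ v a
  automaton-unique χ (inj , surj) (_ , surj′) v a
    with e , s , l ← surj v a | e′ , s′ , l′ ← surj′ v a =
    cong (tgt G) (inj e e′ (trans s (sym s′)) (trans l (sym l′)))

  nonSynchronizingColoring? : Decidable NonSynchronizingColoring
  nonSynchronizingColoring? χ with coloring? χ
  ... | no ¬c = no (¬c ∘ proj₁)
  ... | yes c with synchronizing? (automaton χ c)
  ...   | no ¬sync = yes (c , ¬sync)
  ...   | yes sync = no λ (c′ , ¬sync) →
          ¬sync (synchronizing-cong (automaton-unique χ c c′) sync)

#NSC : ℕ → Digraph → ℕ
#NSC k G =
  length (filter (nonSynchronizingColoring? G) (allVecs (allFin k) (#E G)))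

-- U and W are two disjoint copies of Fin size; the first component of an
-- edge is its endpoint in U, the second its endpoint in W.
record Bipartite : Set where
  field
    size   : ℕ
    #edges : ℕ
    joins  : Vec (Fin size × Fin size) #edges

  left : Fin #edges → Fin size
  left e = proj₁ (lookup joins e)

  right : Fin #edges → Fin size
  right e = proj₂ (lookup joins e)

open Bipartite

IsRegular : ℕ → Bipartite → Set
IsRegular k B =
  (∀ u → count (λ e → proj₁ e Fin.≟ u) (joins B) ≡ k) ×
  (∀ w → count (λ e → proj₂ e Fin.≟ w) (joins B) ≡ k)

H : Bipartite → Digraph
H B = record { #V = size B ; #E = #edges B ; ends = joins B }

PerfectMatching : ∀ B → Subset (#edges B) → Set
PerfectMatching B M =
  (∀ u → ExactlyOne λ e → e ∈ M × left B e ≡ u) ×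
  (∀ w → ExactlyOne λ e → e ∈ M × right B e ≡ w)

record OneFactorization {k} (B : Bipartite) (Ms : Vec (Subset (#edges B)) k)
       : Set where
  constructor oneFactorization
  field
    perfect  : ∀ i → PerfectMatching B (lookup Ms i)
    disjoint : ∀ i j → i ≢ j → lookup Ms i ∩ lookup Ms j ≡ Subset.⊥
    union    : ⋃ (toList Ms) ≡ ⊤

oneFactorization? : ∀ {k} B → Decidable (OneFactorization {k} B)
oneFactorization? B Ms =
  map′ (λ (p , d , u) → oneFactorization p d u)
       (λ (oneFactorization p d u) → p , d , u)
       ((Fin.all? λ i →
          (Fin.all? λ u → exactlyOne? λ e →
            (e ∈? lookup Ms i) ×-dec (left B e Fin.≟ u)) ×-dec
          (Fin.all? λ w → exactlyOne? λ e →
            (e ∈? lookup Ms i) ×-dec (right B e Fin.≟ w)))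
        ×-dec
        (Fin.all? λ i → Fin.all? λ j →
          ¬? (i Fin.≟ j) →-dec ((lookup Ms i ∩ lookup Ms j) ≟ Subset.⊥))
        ×-dec
        (⋃ (toList Ms) ≟ ⊤))
  where
  open import Data.Bool.Properties using () renaming (_≟_ to _≟ᵇ_)
  _≟_ : ∀ {n} (S T : Subset n) → Dec (S ≡ T)
  _≟_ = Vec.≡-dec _≟ᵇ_

#1Fact : ℕ → Bipartite → ℕ
#1Fact k B =
  length (filter (oneFactorization? B) (allVecs (allBits (#edges B)) k))

data Cell (A : Set) : Set where
  blank : Cell A
  bit   : Bool → Cell A
  mark  : A → Cell A

-- A two-way infinite tape: all cells outside `before` (listed from the head
-- outwards), `head` and `after` are blank.
record Tape (A : Set) : Set where
  constructor tape
  field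
    before : List (Cell A)
    head   : Cell A
    after  : List (Cell A)

module _ {A : Set} where

  load : List Bool → Tape A
  load []       = tape [] blank []
  load (b ∷ bs) = tape [] (bit b) (map bit bs)

  bitPrefix : List (Cell A) → List Bool
  bitPrefix (bit b ∷ cs) = b ∷ bitPrefix cs
  bitPrefix _            = []

  -- The word on a tape starts under the head and ends before the first cell
  -- not holding a bit.
  contents : Tape A → List Bool
  contents (tape _ c cs) = bitPrefix (c ∷ cs)

data Direction : Set where
  goLeft stay goRight : Direction

move : ∀ {A} → Direction → Tape A → Tape A
move stay    t                       = t
move goLeft  (tape []       c cs)    = tape [] blank (c ∷ cs)
move goLeft  (tape (b ∷ bs) c cs)    = tape bs b (c ∷ cs)
move goRight (tape bs c [])          = tape (c ∷ bs) blank []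
move goRight (tape bs c (d ∷ cs))    = tape (c ∷ bs) d cs

writeMove : ∀ {A} → Cell A × Direction → Tape A → Tape A
writeMove (c , d) (tape bs _ cs) = move d (tape bs c cs)

data Action (Q A : Set) (t : ℕ) : Set where
  halt : Bool → Action Q A t
  step : Q → Vec (Cell A × Direction) t → Action Q A t
  ask  : Q → Action Q A t

Finite : Set → Set
Finite A = ∃ λ n → A ↔ Fin n

-- Tape 0 holds the input and, on halting, the output. Tape 1 holds the
-- second input (if there is one), and oracle queries and answers.
record Machine : Set₁ where
  field
    State       : Set
    Mark        : Set
    finiteState : Finite State
    finiteMark  : Finite Mark
    #work       : ℕ
    initial     : State
    δ           : State → Vec (Cell Mark) (2 + #work) →
                  Action State Mark (2 + #work)

  Tapes : Set
  Tapes = Vec (Tape Mark) (2 + #work)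

  start : List Bool → List Bool → Tapes
  start x y = load x ∷ load y ∷ Vec.replicate #work (load [])

Oracle : Set₁
Oracle = List Bool → List Bool → Set

noOracle : Oracle
noOracle _ _ = ⊥

-- Run M O q ts n b ts′: from state q and tapes ts, the machine M with oracle
-- O halts after n steps with verdict b and tapes ts′. A query on which O has
-- no answer leaves the machine stuck, so it never halts.
data Run (M : Machine) (O : Oracle) (q : Machine.State M) (ts : Machine.Tapes M)
     : ℕ → Bool → Machine.Tapes M → Set where

  halted  : ∀ {b} →
            Machine.δ M q (Vec.map Tape.head ts) ≡ halt b →
            Run M O q ts 0 b ts

  stepped : ∀ {q′ ms n b ts′} →
            Machine.δ M q (Vec.map Tape.head ts) ≡ step q′ ms →
            Run M O q′ (Vec.zipWith writeMove ms ts) n b ts′ →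
            Run M O q ts (suc n) b ts′

  asked   : ∀ {q′ a n b ts′} →
            Machine.δ M q (Vec.map Tape.head ts) ≡ ask q′ →
            O (contents (lookup ts (suc zero))) a →
            Run M O q′ (ts Vec.[ suc zero ]≔ load a) n b ts′ →
            Run M O q ts (suc n) b ts′

-- Coefficients, constant term first.
Polynomial : Set
Polynomial = List ℕ

⟦_⟧ : Polynomial → ℕ → ℕ
⟦ [] ⟧    n = 0
⟦ a ∷ p ⟧ n = a + n * ⟦ p ⟧ n

-- A counting function on a class of instances, given through binary words.
-- An algorithm may rely on its input being the code of an instance in the
-- class, and may query an oracle for the problem only at such codes.
record CountingProblem : Set₁ where
  field
    Instance : Set
    code     : Instance → List Bool
    value    : Instance → ℕ
    coherent : ∀ i j → code i ≡ code j → value i ≡ value j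

open CountingProblem

total : (List Bool → ℕ) → CountingProblem
total g = record
  { Instance = List Bool
  ; code     = λ x → x
  ; value    = g
  ; coherent = λ _ _ → cong g
  }

-- The value is the number of certificates y ∈ {0,1}^p(|x|) accepted, together
-- with the input x, by a deterministic machine in time polynomial in |x|
-- (equivalently, in |x| + |y|).
record InSharpP (P : CountingProblem) : Set₁ where
  field
    verifier   : Machine
    certLength : Polynomial
    timeBound  : Polynomial

  Certificate : Instance P → Set
  Certificate i = Vec Bool (⟦ certLength ⟧ (length (code P i)))

  field
    accepts : (i : Instance P) → Certificate i → Bool
    decides : ∀ i (y : Certificate i) → ∃₂ λ n ts →
              Run verifier noOracle (Machine.initial verifier)
                  (Machine.start verifier (code P i) (toList y))
                  n (accepts i y) ts ×
              n ≤ ⟦ timeBound ⟧ (length (code P i))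
    counts  : ∀ i → value P i ≡ length (filterᵇ (accepts i) (allBits _))

binary : ℕ → List Bool
binary n = map (λ d → does (d ℕ.≟ 1)) (toNatDigits 2 n)

oracleFor : CountingProblem → Oracle
oracleFor P w a = ∃ λ i → code P i ≡ w × binary (value P i) ≡ a

-- Polynomial-time Turing reducibility: Q can be computed in FP with an
-- oracle for P.
record _≤ᵀ_ (Q P : CountingProblem) : Set₁ where
  field
    machine   : Machine
    timeBound : Polynomial
    computes  : ∀ j → ∃ λ n → ∃₂ λ b ts →
                Run machine (oracleFor P) (Machine.initial machine)
                    (Machine.start machine (code Q j) [])
                    n b ts ×
                n ≤ ⟦ timeBound ⟧ (length (code Q j)) ×
                contents (lookup ts zero) ≡ binary (value Q j)

SharpPHard : CountingProblem → Set₁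
SharpPHard P = ∀ (g : List Bool → ℕ) → InSharpP (total g) → total g ≤ᵀ P

SharpPComplete : CountingProblem → Set₁
SharpPComplete P = InSharpP P × SharpPHard P

-- Vertex numbers are written in unary. For k ≥ 1 the graphs below have at least
-- as many edges as vertices, so this is polynomially equivalent to binary.
unary : ℕ → List Bool
unary n = replicate n true ++ false ∷ []

encodePair : ∀ {n} → Fin n × Fin n → List Bool
encodePair (u , v) = unary (toℕ u) ++ unary (toℕ v)

encodeEdges : ∀ n {m} → Vec (Fin n × Fin n) m → List Bool
encodeEdges n ends = unary n ++ concatMap encodePair (toList ends)

encodeDigraph : Digraph → List Bool
encodeDigraph G = encodeEdges (#V G) (ends G)

encodeBipartite : Bipartite → List Bool
encodeBipartite B = encodeEdges (size B) (joins B)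

private
  unary-injective : ∀ m n {xs ys} → unary m ++ xs ≡ unary n ++ ys →
                    m ≡ n × xs ≡ ys
  unary-injective zero    zero    eq = refl , ∷-injectiveʳ eq
  unary-injective (suc m) (suc n) eq
    with m≡n , rest ← unary-injective m n (∷-injectiveʳ eq) =
    cong suc m≡n , rest
  unary-injective zero    (suc n) ()
  unary-injective (suc m) zero    ()

  pairs-injective : ∀ {n l m} (xs : Vec (Fin n × Fin n) l)
                    (ys : Vec (Fin n × Fin n) m) →
                    concatMap encodePair (toList xs) ≡
                    concatMap encodePair (toList ys) →
                    Σ (l ≡ m) λ eq → subst (Vec _) eq xs ≡ ys
  pairs-injective [] [] _ = refl , refl
  pairs-injective [] ((zero , v) ∷ ys) ()
  pairs-injective [] ((suc u , v) ∷ ys) ()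
  pairs-injective ((zero , v) ∷ xs) [] ()
  pairs-injective ((suc u , v) ∷ xs) [] ()
  pairs-injective ((u , v) ∷ xs) ((u′ , v′) ∷ ys) eq
    with eu , eq₁ ← unary-injective (toℕ u) (toℕ u′)
           (trans (sym (++-assoc (unary (toℕ u)) _ _))
             (trans eq (++-assoc (unary (toℕ u′)) _ _)))
    with ev , eq₂ ← unary-injective (toℕ v) (toℕ v′) eq₁
    with refl , refl ← pairs-injective xs ys eq₂
    with refl ← Fin.toℕ-injective eu | refl ← Fin.toℕ-injective ev
    = refl , refl

encodeDigraph-injective : ∀ G G′ → encodeDigraph G ≡ encodeDigraph G′ → G ≡ G′
encodeDigraph-injective G G′ eq
  with refl , eq₁ ← unary-injective (#V G) (#V G′) eq
  with refl , refl ← pairs-injective (ends G) (ends G′) eq₁ = refl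

encodeBipartite-injective : ∀ B B′ → encodeBipartite B ≡ encodeBipartite B′ →
                            B ≡ B′
encodeBipartite-injective B B′ eq
  with refl , eq₁ ← unary-injective (size B) (size B′) eq
  with refl , refl ← pairs-injective (joins B) (joins B′) eq₁ = refl

OneFactorizationProblem : ℕ → CountingProblem
OneFactorizationProblem k = record
  { Instance = Σ Bipartite λ B →
                 IsRegular k B × Prime (size B) × StronglyConnected (H B)
  ; code     = λ (B , _) → encodeBipartite B
  ; value    = λ (B , _) → #1Fact k B
  ; coherent = λ (B , _) (B′ , _) eq →
                 cong (#1Fact k) (encodeBipartite-injective B B′ eq)
  }

NonSynchronizingProblem : ℕ → CountingProblem
NonSynchronizingProblem k = record
  { Instance = Σ Digraph λ G →
                 IsEulerian k G × StronglyConnected G × Prime (#V G)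
  ; code     = λ (G , _) → encodeDigraph G
  ; value    = λ (G , _) → #NSC k G
  ; coherent = λ (G , _) (G′ , _) eq →
                 cong (#NSC k) (encodeDigraph-injective G G′ eq)
  }

{-# OPTIONS --safe #-}
-- In an Eulerian automaton the k letter preimages of a vertex set S have total
-- size k|S|. Hence every preimage of a largest fibre of a word is again a
-- largest fibre, and strong connectivity yields one word all of whose nonempty
-- fibres are largest (Friedman). Their common size divides the number of
-- vertices; if that number is prime, the automaton is synchronizing or every
-- letter permutes the vertices. So on the class at hand a coloring is
-- non-synchronizing exactly if its color classes are perfect matchings.
-- Therefore #NSC(H_B) = #1Fact(B), and as B and H_B have the same code, the
-- machine of a reduction to #1Fact is one to #NSC. For membership in #P, no word
-- has to be considered: a certificate is a list of edge colors, and a machine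
-- only has to see that no color repeats at the source or the target side of a
-- vertex.
module Submission where

open import Data.Nat.Base using (ℕ; _≤_)
open import Data.Product.Base using (_×_)
open import Defs

open import Data.Bool.Base using (Bool; true; false; if_then_else_; not; T)
open import Data.Bool.ListAction using (all)
open import Data.Bool.Properties using (T?; T-≡)
open import Data.Empty using (⊥)
open import Data.Fin.Base as Fin using (Fin; zero; suc; toℕ; fromℕ; inject₁; combine)
open import Data.Fin.Patterns using (0F; 1F; 2F; 3F; 4F)
import Data.Fin.Properties as Fin
open import Data.Fin.Subset as Subset using (Subset; ⁅_⁆; ⋃; ∣_∣; _∈_)
import Data.Fin.Subset.Properties as Subset
open import Data.List.Base as List
  using (List; []; _∷_; _++_; length; map; allFin; filter; replicate; concatMap)
open import Data.List.Membership.Propositional using () renaming (_∈_ to _∈ₗ_)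
open import Data.List.Membership.Propositional.Properties
  using (∈-allFin; ∈-map⁺; ∈-map⁻; ∈-filter⁺; ∈-filter⁻; ∈-lookup; ∈-cartesianProductWith⁺)
open import Data.List.Membership.Setoid.Properties using (index-injective)
open import Data.List.Properties
  using (foldl-++; length-map; length-++; length-replicate; ++-assoc; ∷-injectiveˡ; ∷-injectiveʳ)
open import Data.List.Relation.Unary.All as All using (All; []; _∷_)
open import Data.List.Relation.Unary.AllPairs using ([]; _∷_)
open import Data.List.Relation.Unary.Any as Any using (here; there)
open import Data.List.Relation.Unary.Unique.Propositional using (Unique)
import Data.List.Relation.Unary.Unique.Propositional.Properties as Unique
open import Data.Maybe.Base using (Maybe; just; nothing)
open import Data.Maybe.Properties using (just-injective)
open import Data.Nat.Base
  using (zero; suc; _+_; _*_; _∸_; _^_; _<_; z≤n; s≤s; nonTrivial⇒n>1)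
open import Data.Nat.Divisibility using (_∣_; _∣0; ∣-refl; ∣m∣n⇒∣m+n)
open import Data.Nat.Primality using (Prime; prime⇒irreducible; prime⇒nonTrivial)
import Data.Nat.Properties as ℕ
open import Data.Nat.Solver using (module +-*-Solver)
open import Data.Product.Base using (∃; ∃₂; _,_; proj₁; proj₂; uncurry)
open import Data.Product.Function.NonDependent.Propositional using (_×-↔_)
open import Data.Product.Properties using (,-injective)
open import Data.Sum.Base using (_⊎_; inj₁; inj₂)
open import Data.Unit.Base using (⊤)
open import Data.Vec.Base as Vec
  using (Vec; []; _∷_; lookup; count; tabulate; toList; _[_]≔_)
open import Data.Vec.Membership.Propositional.Properties
  using (∈-toList⁺; ∈-toList⁻) renaming (∈-lookup to vec-∈-lookup)
import Data.Vec.Properties as Vec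
open import Data.Vec.Relation.Binary.Pointwise.Extensional using (ext; Pointwise-≡⇒≡)
import Data.Vec.Relation.Unary.Any as VecAny
open import Data.Vec.Relation.Unary.Any.Properties using ()
  renaming (lookup-index to vec-lookup-index)
open import Function.Base using (_∘_)
open import Function.Bundles using (_↔_; mk↔ₛ′; Equivalence)
open import Function.Properties.Inverse using (↔-refl; ↔-sym; ↔-trans)
open import Relation.Binary.Construct.Closure.ReflexiveTransitive using (Star; ε; _◅_)
open import Relation.Binary.PropositionalEquality
  using (_≡_; _≢_; refl; sym; trans; cong; cong₂; subst; setoid; module ≡-Reasoning)
open import Relation.Nullary using (¬_; Dec; yes; no; does)
open import Relation.Nullary.Decidable using (decidable-stable; dec-true; dec-false)
open import Relation.Nullary.Negation using (contradiction)
open import Relation.Unary using (Decidable)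
open import Algebra.Properties.Semiring.Sum ℕ.+-*-semiring
  using (sum; sum-cong-≗; ∑-comm; *-distribˡ-sum)

open Digraph

-- Sums of natural numbers

𝟙 : ∀ {P : Set} → Dec P → ℕ
𝟙 d = if does d then 1 else 0

module _ {P : Set} where

  𝟙-yes : (d : Dec P) → P → 𝟙 d ≡ 1
  𝟙-yes (yes _) _ = refl
  𝟙-yes (no ¬p) p = contradiction p ¬p

  𝟙-no : (d : Dec P) → ¬ P → 𝟙 d ≡ 0
  𝟙-no (yes p) ¬p = contradiction p ¬p
  𝟙-no (no _)  _  = refl

  𝟙-holds : (d : Dec P) → 0 < 𝟙 d → P
  𝟙-holds (yes p) _ = p

  𝟙≤1 : (d : Dec P) → 𝟙 d ≤ 1
  𝟙≤1 (yes _) = s≤s z≤n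
  𝟙≤1 (no _)  = z≤n

𝟙-cong : ∀ {P Q : Set} (d : Dec P) (d′ : Dec Q) → (P → Q) → (Q → P) → 𝟙 d ≡ 𝟙 d′
𝟙-cong (yes p) d′ f g = sym (𝟙-yes d′ (f p))
𝟙-cong (no ¬p) d′ f g = sym (𝟙-no d′ (¬p ∘ g))

sum-mono : ∀ {n} {f g : Fin n → ℕ} → (∀ i → f i ≤ g i) → sum f ≤ sum g
sum-mono {zero}  f≤g = z≤n
sum-mono {suc n} f≤g = ℕ.+-mono-≤ (f≤g zero) (sum-mono (f≤g ∘ suc))

sum-const : ∀ n c → sum {n} (λ _ → c) ≡ n * c
sum-const zero    c = refl
sum-const (suc n) c = cong (c +_) (sum-const n c)

sum-zero : ∀ {n} {f : Fin n → ℕ} → (∀ i → f i ≡ 0) → sum f ≡ 0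
sum-zero {n} f≡0 = trans (sum-cong-≗ f≡0) (trans (sum-const n 0) (ℕ.*-zeroʳ n))

sum-positive : ∀ {n} (f : Fin n → ℕ) → 0 < sum f → ∃ λ i → 0 < f i
sum-positive {suc n} f 0<sum with f zero in eq
... | suc _ = zero , ℕ.≤-trans (s≤s z≤n) (ℕ.≤-reflexive (sym eq))
... | zero  with i , 0<fi ← sum-positive (f ∘ suc) 0<sum = suc i , 0<fi

term≤sum : ∀ {n} (f : Fin n → ℕ) i → f i ≤ sum f
term≤sum f zero    = ℕ.m≤m+n _ _
term≤sum f (suc i) = ℕ.≤-trans (term≤sum (f ∘ suc) i) (ℕ.m≤n+m _ _)

terms≤sum : ∀ {n} (f : Fin n → ℕ) {i j} → i ≢ j → f i + f j ≤ sum f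
terms≤sum f {zero}  {zero}  i≢j = contradiction refl i≢j
terms≤sum f {zero}  {suc j} i≢j = ℕ.+-monoʳ-≤ _ (term≤sum (f ∘ suc) j)
terms≤sum f {suc i} {zero}  i≢j =
  ℕ.≤-trans (ℕ.≤-reflexive (ℕ.+-comm _ (f zero))) (ℕ.+-monoʳ-≤ _ (term≤sum (f ∘ suc) i))
terms≤sum f {suc i} {suc j} i≢j =
  ℕ.≤-trans (terms≤sum (f ∘ suc) (i≢j ∘ cong suc)) (ℕ.m≤n+m _ _)

sum≤1 : ∀ {n} {f : Fin n → ℕ} → (∀ i → f i ≤ 1) →
        (∀ i j → 0 < f i → 0 < f j → i ≡ j) → sum f ≤ 1
sum≤1 {zero}      f≤1 unique = z≤n
sum≤1 {suc n} {f} f≤1 unique with f zero in eq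
... | zero  = sum≤1 (f≤1 ∘ suc) λ i j p q → Fin.suc-injective (unique (suc i) (suc j) p q)
... | suc m = ℕ.≤-trans (ℕ.≤-reflexive (trans (cong (suc m +_) rest) (ℕ.+-identityʳ _)))
                        (subst (_≤ 1) eq (f≤1 zero))
  where
  rest : sum (f ∘ suc) ≡ 0
  rest with sum (f ∘ suc) in eq′
  ... | zero = refl
  ... | suc _ with i , p ← sum-positive (f ∘ suc) (ℕ.≤-trans (s≤s z≤n) (ℕ.≤-reflexive (sym eq′)))
    with () ← unique zero (suc i) (ℕ.≤-trans (s≤s z≤n) (ℕ.≤-reflexive (sym eq))) p

-- Kronecker deltas are the tool for double counting here: a term is expanded into a sum of
-- indicators, and `∑-comm` then exchanges the order of summation.
sum-delta : ∀ {n} j (f : Fin n → ℕ) → sum (λ i → 𝟙 (i Fin.≟ j) * f i) ≡ f j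
sum-delta {suc n} zero    f =
  trans (cong₂ _+_ (ℕ.*-identityˡ (f zero)) (sum-zero {n} {λ _ → 0} λ _ → refl)) (ℕ.+-identityʳ _)
sum-delta (suc j) f =
  trans (sum-cong-≗ λ i → cong (_* f (suc i))
          (𝟙-cong (suc i Fin.≟ suc j) (i Fin.≟ j) Fin.suc-injective (cong suc)))
        (sum-delta j (f ∘ suc))

sum-delta′ : ∀ {n} j (f : Fin n → ℕ) → sum (λ i → 𝟙 (j Fin.≟ i) * f i) ≡ f j
sum-delta′ j f = trans
  (sum-cong-≗ λ i → cong (_* f i) (𝟙-cong (j Fin.≟ i) (i Fin.≟ j) sym sym))
  (sum-delta j f)

-- There is no slack: a term below `c` would need another one above `c` to make up for it. The
-- averaging arguments below rest on this.
saturated : ∀ {n c} {f : Fin n → ℕ} → (∀ i → f i ≤ c) → n * c ≤ sum f → ∀ i → f i ≡ c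
saturated {suc n} {c} {f} f≤c full = λ where
    zero    → ℕ.≤-antisym (f≤c zero) (ℕ.+-cancelʳ-≤ (n * c) _ _
                (ℕ.≤-trans full (ℕ.+-monoʳ-≤ (f zero) rest≤)))
    (suc i) → saturated (f≤c ∘ suc)
                (ℕ.+-cancelˡ-≤ c _ _ (ℕ.≤-trans full (ℕ.+-monoˡ-≤ _ (f≤c zero)))) i
  where
  rest≤ : sum (f ∘ suc) ≤ n * c
  rest≤ = ℕ.≤-trans (sum-mono (f≤c ∘ suc)) (ℕ.≤-reflexive (sum-const n c))

∣sum : ∀ {n d} {f : Fin n → ℕ} → (∀ i → d ∣ f i) → d ∣ sum f
∣sum {zero}  {d} d∣f = d ∣0
∣sum {suc n} d∣f = ∣m∣n⇒∣m+n (d∣f zero) (∣sum (d∣f ∘ suc))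

count≡sum : ∀ {A : Set} {P : A → Set} (P? : Decidable P) {m} (xs : Vec A m) →
            count P? xs ≡ sum (λ i → 𝟙 (P? (lookup xs i)))
count≡sum P? []       = refl
count≡sum P? (x ∷ xs) with does (P? x)
... | true  = cong suc (count≡sum P? xs)
... | false = count≡sum P? xs

-- Unions and images of finite subsets

x∈⋃⁺ : ∀ {n} {x : Fin n} {p ps} → p ∈ₗ ps → x ∈ p → x ∈ ⋃ ps
x∈⋃⁺ (here refl) x∈p = Subset.x∈p∪q⁺ (inj₁ x∈p)
x∈⋃⁺ (there p∈)  x∈p = Subset.x∈p∪q⁺ (inj₂ (x∈⋃⁺ p∈ x∈p))

x∈⋃⁻ : ∀ {n} {x : Fin n} ps → x ∈ ⋃ ps → ∃ λ p → p ∈ₗ ps × x ∈ p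
x∈⋃⁻ []       x∈ = contradiction x∈ Subset.∉⊥
x∈⋃⁻ (p ∷ ps) x∈ with Subset.x∈p∪q⁻ p _ x∈
... | inj₁ x∈p = p , here refl , x∈p
... | inj₂ x∈⋃ with q , q∈ , x∈q ← x∈⋃⁻ ps x∈⋃ = q , there q∈ , x∈q

module _ {m n} (f : Fin m → Fin n) where

  ∈image : ∀ v → f v ∈ image f
  ∈image v = x∈⋃⁺ (∈-map⁺ (λ v → ⁅ f v ⁆) (∈-allFin v)) (Subset.x∈⁅x⁆ (f v))

  constant⇒∣image∣≡1 : ∀ v q → (∀ u → f u ≡ q) → ∣ image f ∣ ≡ 1
  constant⇒∣image∣≡1 v q f≡q = trans (cong ∣_∣ image≡⁅q⁆) (Subset.∣⁅x⁆∣≡1 q)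
    where
    image⊆ : ∀ {x} → x ∈ image f → x ∈ ⁅ q ⁆
    image⊆ x∈ with _ , p∈ , x∈p ← x∈⋃⁻ (map (λ v → ⁅ f v ⁆) (allFin m)) x∈
               with u , _ , refl ← ∈-map⁻ (λ v → ⁅ f v ⁆) p∈ =
      subst (λ y → _ ∈ ⁅ y ⁆) (f≡q u) x∈p
    image≡⁅q⁆ : image f ≡ ⁅ q ⁆
    image≡⁅q⁆ = Subset.⊆-antisym image⊆ λ x∈ →
      subst (_∈ image f) (trans (f≡q v) (sym (Subset.x∈⁅y⁆⇒x≡y q x∈))) (∈image v)

  ∣image∣≡1⇒constant : ∣ image f ∣ ≡ 1 → ∀ u v → f u ≡ f v
  ∣image∣≡1⇒constant one u v with f u Fin.≟ f v
  ... | yes eq = eq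
  -- Removing `f v` already empties a one-element image, yet `f u` could still be removed from the
  -- rest.
  ... | no neq = contradiction
    (ℕ.<-≤-trans (Subset.x∈p⇒∣p-x∣<∣p∣ (Subset.x∈p∧x≢y⇒x∈p-y (∈image u) neq))
      (ℕ.≤-pred (ℕ.<-≤-trans (Subset.x∈p⇒∣p-x∣<∣p∣ (∈image v)) (ℕ.≤-reflexive one))))
    λ ()

-- Automata with balanced letters

-- `balanced` is the weighted form of having `k` incoming transitions at each vertex; as `g` may be
-- any weight, it applies directly to the indicator of a fibre.
module Balanced {n k : ℕ} (δ : Transition n k)
  (balanced : ∀ (g : Fin n → ℕ) → sum (λ v → sum (λ a → g (δ v a))) ≡ k * sum g)
  (transitive : ∀ u v → ∃ λ w → run δ w u ≡ v)
  where

  fibre : List (Fin k) → Fin n → ℕ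
  fibre w q = sum (λ v → 𝟙 (run δ w v Fin.≟ q))

  fibre≤n : ∀ w q → fibre w q ≤ n
  fibre≤n w q = ℕ.≤-trans (sum-mono λ v → 𝟙≤1 (run δ w v Fin.≟ q))
                          (ℕ.≤-reflexive (trans (sum-const n 1) (ℕ.*-identityʳ n)))

  0<fibre : ∀ w v → 0 < fibre w (run δ w v)
  0<fibre w v = ℕ.≤-trans (ℕ.≤-reflexive (sym (𝟙-yes (run δ w v Fin.≟ _) refl)))
                          (term≤sum _ v)

  -- Words act from their first letter on, so the fibre of `a ∷ w` over `q` is the preimage under
  -- `a` of the fibre of `w`; `balanced` adds up these preimages.
  preimages : ∀ w q → sum (λ a → fibre (a ∷ w) q) ≡ k * fibre w q
  preimages w q = trans (∑-comm λ a v → 𝟙 (run δ (a ∷ w) v Fin.≟ q))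
                        (balanced λ u → 𝟙 (run δ w u Fin.≟ q))

  Maximal : ℕ → Set
  Maximal M = ∃₂ λ t q → fibre t q ≡ M × (∀ w p → fibre w p ≤ M)

  -- The goal of nonSynchronizing⇒injective is decidable, so a maximum is needed
  -- only up to double negation.
  maximum : ∀ w q d → n ≤ d + fibre w q → ¬ ¬ ∃ Maximal
  maximum w q zero    n≤ ¬max = ¬max (fibre w q , w , q , refl , λ w′ q′ →
    ℕ.≤-trans (fibre≤n w′ q′) n≤)
  maximum w q (suc d) n≤ ¬max = ¬max (fibre w q , w , q , refl , λ w′ q′ →
    ℕ.≮⇒≥ λ larger → maximum w′ q′ d
      (ℕ.≤-trans n≤ (ℕ.≤-trans (ℕ.≤-reflexive (sym (ℕ.+-suc d _))) (ℕ.+-monoʳ-≤ d larger))) ¬max)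

  module _ {M t q} (fibre≡M : fibre t q ≡ M) (fibre≤M : ∀ w p → fibre w p ≤ M) where

    -- The k fibres of the words a ∷ w have average size M, hence none is smaller.
    extend : ∀ u w p → fibre w p ≡ M → fibre (u ++ w) p ≡ M
    extend []      w p eq = eq
    extend (a ∷ u) w p eq = saturated (λ b → fibre≤M (b ∷ u ++ w) p)
      (ℕ.≤-reflexive (trans (cong (k *_) (sym (extend u w p eq))) (sym (preimages (u ++ w) p)))) a

    fibre-++ : ∀ w w′ v → fibre w (run δ w v) ≤ fibre (w ++ w′) (run δ (w ++ w′) v)
    fibre-++ w w′ v = sum-mono coarser
      where
      coarser : ∀ u → 𝟙 (run δ w u Fin.≟ run δ w v) ≤
                      𝟙 (run δ (w ++ w′) u Fin.≟ run δ (w ++ w′) v)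
      coarser u with run δ w u Fin.≟ run δ w v
      ... | no _   = z≤n
      ... | yes eq = ℕ.≤-reflexive (sym (𝟙-yes (run δ (w ++ w′) u Fin.≟ _) (begin
          run δ (w ++ w′) u      ≡⟨ foldl-++ δ u w w′ ⟩
          run δ w′ (run δ w u)   ≡⟨ cong (run δ w′) eq ⟩
          run δ w′ (run δ w v)   ≡⟨ foldl-++ δ v w w′ ⟨
          run δ (w ++ w′) v      ∎)))
        where open ≡-Reasoning

    -- After w, lead v into the fibre of t over q; this coarsens the fibres of w,
    -- so the largest ones survive.
    merge : ∀ s → run δ t s ≡ q → ∀ vs →
            ∃ λ w → All (λ v → fibre w (run δ w v) ≡ M) vs
    merge s ts≡q [] = [] , []
    merge s ts≡q (v ∷ vs)
      with w , full ← merge s ts≡q vs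
      with u , eq ← transitive (run δ w v) s =
      w ++ u ++ t , head ∷ All.map (λ {x} e →
        ℕ.≤-antisym (fibre≤M (w ++ u ++ t) _)
          (subst (_≤ fibre (w ++ u ++ t) (run δ (w ++ u ++ t) x)) e (fibre-++ w (u ++ t) x))) full
      where
      v↦q : run δ (w ++ u ++ t) v ≡ q
      v↦q = begin
        run δ (w ++ u ++ t) v            ≡⟨ foldl-++ δ v w (u ++ t) ⟩
        run δ (u ++ t) (run δ w v)       ≡⟨ foldl-++ δ (run δ w v) u t ⟩
        run δ t (run δ u (run δ w v))    ≡⟨ cong (run δ t) eq ⟩
        run δ t s                        ≡⟨ ts≡q ⟩
        q                                ∎
        where open ≡-Reasoning
      head : fibre (w ++ u ++ t) (run δ (w ++ u ++ t) v) ≡ M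
      head = trans (cong (fibre (w ++ u ++ t)) v↦q) (extend w (u ++ t) q (extend u t q fibre≡M))

    -- Applied to the list of all vertices, `merge` gives a word all of whose nonempty fibres have
    -- size `M`; they partition the `n` vertices. Positivity of `M` supplies the vertex `s`, in the
    -- fibre of `t` over `q`, to which `merge` leads.
    maximal∣n : 0 < M → M ∣ n
    maximal∣n 0<M
      with s , 0<𝟙 ← sum-positive (λ v → 𝟙 (run δ t v Fin.≟ q)) (subst (0 <_) (sym fibre≡M) 0<M)
      with w , full ← merge s (𝟙-holds (run δ t s Fin.≟ q) 0<𝟙) (allFin n) =
      subst (M ∣_) total≡n (∣sum M∣fibre)
      where
      M∣fibre : ∀ p → M ∣ fibre w p
      M∣fibre p with fibre w p in eq
      ... | zero  = M ∣0
      ... | suc _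
        with v , 0<𝟙 ← sum-positive (λ v → 𝟙 (run δ w v Fin.≟ p)) (subst (0 <_) (sym eq) (s≤s z≤n))
        with refl ← 𝟙-holds (run δ w v Fin.≟ p) 0<𝟙 =
        subst (M ∣_) (trans (sym (All.lookup full (∈-allFin v))) eq) ∣-refl
      total≡n : sum (fibre w) ≡ n
      total≡n = begin
        sum (fibre w)
          ≡⟨ ∑-comm (λ p v → 𝟙 (run δ w v Fin.≟ p)) ⟩
        sum (λ v → sum (λ p → 𝟙 (run δ w v Fin.≟ p)))
          ≡⟨ sum-cong-≗ (λ v → trans (sum-cong-≗ λ p → sym (ℕ.*-identityʳ (𝟙 (run δ w v Fin.≟ p))))
                                     (sum-delta′ (run δ w v) (λ _ → 1))) ⟩
        sum {n} (λ _ → 1)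
          ≡⟨ trans (sum-const n 1) (ℕ.*-identityʳ n) ⟩
        n ∎
        where open ≡-Reasoning

  -- The `n` indicators are at most 1 and add up to `n`, hence none vanishes. The vertex argument
  -- guarantees that the image is nonempty.
  full⇒synchronizing : ∀ {t q} → Fin n → fibre t q ≡ n → Synchronizing δ
  full⇒synchronizing {t} {q} v eq = t , constant⇒∣image∣≡1 (run δ t) v q λ u →
    𝟙-holds (run δ t u Fin.≟ q) (ℕ.≤-reflexive (sym (saturated
      (λ v → 𝟙≤1 (run δ t v Fin.≟ q)) (ℕ.≤-reflexive (trans (ℕ.*-identityʳ n) (sym eq))) u)))

  -- If `a` merged two distinct vertices, the maximal fibre size `M` would be at least 2. As `M`
  -- divides the prime `n`, it would equal `n`, and a word with a fibre of that size synchronizes.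
  nonSynchronizing⇒injective : Prime n → ¬ Synchronizing δ →
                               ∀ a {u v} → δ u a ≡ δ v a → u ≡ v
  nonSynchronizing⇒injective pr ¬sync a {u} {v} eq = decidable-stable (u Fin.≟ v) λ u≢v →
    -- The search for a maximum starts from the fibre of the empty word over `u`, with `n` as the
    -- room left for growth.
    maximum [] u n (ℕ.m≤m+n n _) λ { (M , t , q , fibre≡M , fibre≤M) →
      let M∣n = maximal∣n {t = t} {q} fibre≡M fibre≤M (ℕ.<-≤-trans (0<fibre [] u) (fibre≤M [] u))
      in case u≢v M t q fibre≡M fibre≤M (prime⇒irreducible pr M∣n) }
    where
    case : u ≢ v → ∀ M t q → fibre t q ≡ M → (∀ w p → fibre w p ≤ M) → M ≡ 1 ⊎ M ≡ n → ⊥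
    case u≢v M t q fibre≡M fibre≤M (inj₂ refl) = ¬sync (full⇒synchronizing {t} u fibre≡M)
    -- Both `u` and `v` lie in one fibre of the one-letter word `a`, which is too many for `M ≡ 1`.
    case u≢v M t q fibre≡M fibre≤M (inj₁ refl) = contradiction
      (ℕ.≤-trans (ℕ.≤-reflexive (sym (cong₂ _+_
          (𝟙-yes (δ u a Fin.≟ δ v a) eq) (𝟙-yes (δ v a Fin.≟ δ v a) refl))))
        (ℕ.≤-trans (terms≤sum (λ x → 𝟙 (δ x a Fin.≟ δ v a)) u≢v) (fibre≤M (a ∷ []) (δ v a))))
      λ { (s≤s ()) }

-- Counting by bijections

-- Each position of `xs` is sent to the position of the same element in `ys`; this is injective
-- because `xs` has no repetitions.
length-unique-≤ : ∀ {A : Set} {xs ys : List A} → Unique xs →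
                  (∀ {x} → x ∈ₗ xs → x ∈ₗ ys) → length xs ≤ length ys
length-unique-≤ {A} {xs} {ys} unique sub =
  Fin.injective⇒≤ {f = λ i → Any.index (sub (∈-lookup′ i))} λ {i} {j} eq →
    lookup-injective unique i j
      (index-injective (setoid A) (sub (∈-lookup′ i)) (sub (∈-lookup′ j)) eq)
  where
  ∈-lookup′ : ∀ i → List.lookup xs i ∈ₗ xs
  ∈-lookup′ i = ∈-lookup i
  lookup-injective : ∀ {zs : List A} → Unique zs → ∀ i j →
                     List.lookup zs i ≡ List.lookup zs j → i ≡ j
  lookup-injective (_ ∷ _)  zero    zero    eq = refl
  lookup-injective (z∉ ∷ _) zero    (suc j) eq =
    contradiction eq (All.lookup z∉ (∈-lookup j))
  lookup-injective (z∉ ∷ _) (suc i) zero    eq =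
    contradiction (sym eq) (All.lookup z∉ (∈-lookup i))
  lookup-injective (_ ∷ u)  (suc i) (suc j) eq = cong suc (lookup-injective u i j eq)

Enumerates : ∀ {A : Set} → List A → Set
Enumerates xs = Unique xs × (∀ x → x ∈ₗ xs)

allVecs-enumerates : ∀ {A : Set} {xs : List A} → Enumerates xs → ∀ n → Enumerates (allVecs xs n)
allVecs-enumerates _ zero = ([] ∷ []) , λ { [] → here refl }
allVecs-enumerates xs@(unique , complete) (suc n) with u , c ← allVecs-enumerates xs n =
  Unique.cartesianProductWith⁺ _∷_ Vec.∷-injective unique u ,
  λ { (x ∷ v) → ∈-cartesianProductWith⁺ _∷_ (complete x) (c v) }

bits-enumerates : Enumerates (true ∷ false ∷ [])
bits-enumerates = ((λ ()) ∷ []) ∷ [] ∷ [] , λ { true → here refl ; false → there (here refl) }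

module _ {A B : Set} {P : A → Set} {Q : B → Set} (P? : Decidable P) (Q? : Decidable Q)
         {xs : List A} {ys : List B} (enum-xs : Enumerates xs) (enum-ys : Enumerates ys)
         (f : A → B) (injective : ∀ {x x′} → f x ≡ f x′ → x ≡ x′)
         (sound : ∀ x → P x → Q (f x)) (onto : ∀ y → Q y → ∃ λ x → P x × f x ≡ y)
  where

  filter-bijection : length (filter P? xs) ≡ length (filter Q? ys)
  filter-bijection = trans (sym (length-map f (filter P? xs))) (ℕ.≤-antisym
    (length-unique-≤ (Unique.map⁺ injective (Unique.filter⁺ P? (proj₁ enum-xs))) to)
    (length-unique-≤ (Unique.filter⁺ Q? (proj₁ enum-ys)) from))
    where
    to : ∀ {y} → y ∈ₗ map f (filter P? xs) → y ∈ₗ filter Q? ys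
    to y∈ with x , x∈ , refl ← ∈-map⁻ f y∈ =
      ∈-filter⁺ Q? (proj₂ enum-ys (f x)) (sound x (proj₂ (∈-filter⁻ P? {xs = xs} x∈)))
    from : ∀ {y} → y ∈ₗ filter Q? ys → y ∈ₗ map f (filter P? xs)
    from {y} y∈ with x , px , refl ← onto y (proj₂ (∈-filter⁻ Q? {xs = ys} y∈)) =
      ∈-map⁺ f (∈-filter⁺ P? (proj₂ enum-xs x) px)

-- Colorings and 1-factorizations

-- For an endpoint map `p`, this is properness of the edge coloring `χ` at that end.
Separates : ∀ {m n k} → (Fin m → Fin n) → (Fin m → Fin k) → Set
Separates p χ = ∀ e e′ → p e ≡ p e′ → χ e ≡ χ e′ → e ≡ e′

-- The `k` edges at `v` are distributed over `k` colors, each taken at most once; by `saturated`,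
-- each is taken exactly once.
separates⇒hits : ∀ {m n k} {p : Fin m → Fin n} {χ : Fin m → Fin k} → Separates p χ →
                 ∀ v → sum (λ e → 𝟙 (p e Fin.≟ v)) ≡ k → ∀ a → ∃ λ e → p e ≡ v × χ e ≡ a
separates⇒hits {m} {k = k} {p} {χ} sep v degree≡k a =
  let e , 0<term = sum-positive (λ e → term e a)
                     (ℕ.≤-reflexive (sym (saturated multiplicity≤1 full a)))
      0<χ , 0<p  = both e a 0<term
  in e , 𝟙-holds (p e Fin.≟ v) 0<p , 𝟙-holds (χ e Fin.≟ a) 0<χ
  where
  term : Fin m → Fin k → ℕ
  term e b = 𝟙 (χ e Fin.≟ b) * 𝟙 (p e Fin.≟ v)
  both : ∀ e b → 0 < term e b → 0 < 𝟙 (χ e Fin.≟ b) × 0 < 𝟙 (p e Fin.≟ v)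
  both e b 0<xy with χ e Fin.≟ b | p e Fin.≟ v
  ... | yes _ | yes _ = s≤s z≤n , s≤s z≤n
  multiplicity≤1 : ∀ b → sum (λ e → term e b) ≤ 1
  multiplicity≤1 b = sum≤1
    (λ e → ℕ.*-mono-≤ (𝟙≤1 (χ e Fin.≟ b)) (𝟙≤1 (p e Fin.≟ v)))
    λ e e′ 0<t 0<t′ → let χe , pe = both e b 0<t ; χe′ , pe′ = both e′ b 0<t′ in
      sep e e′ (trans (𝟙-holds (p e Fin.≟ v) pe) (sym (𝟙-holds (p e′ Fin.≟ v) pe′)))
               (trans (𝟙-holds (χ e Fin.≟ b) χe) (sym (𝟙-holds (χ e′ Fin.≟ b) χe′)))
  full : k * 1 ≤ sum (λ b → sum (λ e → term e b))
  full = ℕ.≤-reflexive (begin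
    k * 1                            ≡⟨ ℕ.*-identityʳ k ⟩
    k                                ≡⟨ degree≡k ⟨
    sum (λ e → 𝟙 (p e Fin.≟ v))      ≡⟨ sum-cong-≗ (λ e → sum-delta′ (χ e) λ _ → 𝟙 (p e Fin.≟ v)) ⟨
    sum (λ e → sum (term e))         ≡⟨ ∑-comm term ⟩
    sum (λ b → sum (λ e → term e b)) ∎)
    where open ≡-Reasoning

-- Proper edge colorings of the bipartite graph that has a source copy and a target copy of every
-- vertex.
Latin : ∀ {k n m} → Vec (Fin n × Fin n) m → Vec (Fin k) m → Set
Latin ends χ =
  Separates (proj₁ ∘ lookup ends) (lookup χ) × Separates (proj₂ ∘ lookup ends) (lookup χ)

module _ {k : ℕ} (G : Digraph) (χ : Vec (Fin k) (#E G)) where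

  -- A coloring puts pairs of a vertex and a letter in bijection with the edges; `match` expresses
  -- this as an identity of deltas, and the sums over `a` and `v` are then carried out.
  edgesBySource : ∀ (c : IsColoring G χ) (f : E G → ℕ) →
                  sum (λ v → sum (λ a → f (proj₁ (proj₂ c v a)))) ≡ sum f
  edgesBySource (inj , surj) f = begin
    sum (λ v → sum (λ a → f (edge v a)))
      ≡⟨ sum-cong-≗ (λ v → sum-cong-≗ λ a →
           trans (sym (sum-delta (edge v a) f)) (sum-cong-≗ (match v a))) ⟩
    sum (λ v → sum (λ a → sum (λ e → 𝟙 (src G e Fin.≟ v) * (𝟙 (lookup χ e Fin.≟ a) * f e))))
      ≡⟨ sum-cong-≗ (λ v → ∑-comm λ a e → 𝟙 (src G e Fin.≟ v) * (𝟙 (lookup χ e Fin.≟ a) * f e)) ⟩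
    sum (λ v → sum (λ e → sum (λ a → 𝟙 (src G e Fin.≟ v) * (𝟙 (lookup χ e Fin.≟ a) * f e))))
      ≡⟨ sum-cong-≗ (λ v → sum-cong-≗ λ e → trans
           (sym (*-distribˡ-sum (𝟙 (src G e Fin.≟ v)) (λ a → 𝟙 (lookup χ e Fin.≟ a) * f e)))
           (cong (𝟙 (src G e Fin.≟ v) *_) (sum-delta′ (lookup χ e) λ _ → f e))) ⟩
    sum (λ v → sum (λ e → 𝟙 (src G e Fin.≟ v) * f e))
      ≡⟨ ∑-comm (λ v e → 𝟙 (src G e Fin.≟ v) * f e) ⟩
    sum (λ e → sum (λ v → 𝟙 (src G e Fin.≟ v) * f e))
      ≡⟨ sum-cong-≗ (λ e → sum-delta′ (src G e) λ _ → f e) ⟩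
    sum f ∎
    where
    open ≡-Reasoning
    edge : V G → Fin k → E G
    edge v a = proj₁ (surj v a)
    match : ∀ v a e → 𝟙 (e Fin.≟ edge v a) * f e ≡
                      𝟙 (src G e Fin.≟ v) * (𝟙 (lookup χ e Fin.≟ a) * f e)
    match v a e with surj v a
    ... | e′ , s , l with src G e Fin.≟ v | lookup χ e Fin.≟ a
    ...   | yes s′ | yes l′ = trans
      (cong (_* f e) (𝟙-yes (e Fin.≟ e′) (inj e e′ (trans s′ (sym s)) (trans l′ (sym l)))))
      (sym (ℕ.*-identityˡ _))
    ...   | yes s′ | no l′ = cong (_* f e) (𝟙-no (e Fin.≟ e′) λ { refl → l′ l })
    ...   | no s′ | _ = cong (_* f e) (𝟙-no (e Fin.≟ e′) λ { refl → s′ s })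

  automaton-balanced : (∀ v → indegree G v ≡ k) → ∀ (c : IsColoring G χ) (g : V G → ℕ) →
                       sum (λ v → sum (λ a → g (automaton G χ c v a))) ≡ k * sum g
  automaton-balanced indegree≡k c g = begin
    sum (λ v → sum (λ a → g (automaton G χ c v a)))
      ≡⟨ edgesBySource c (g ∘ tgt G) ⟩
    sum (g ∘ tgt G)
      ≡⟨ sum-cong-≗ (λ e → sum-delta′ (tgt G e) g) ⟨
    sum (λ e → sum (λ v → 𝟙 (tgt G e Fin.≟ v) * g v))
      ≡⟨ ∑-comm (λ e v → 𝟙 (tgt G e Fin.≟ v) * g v) ⟩
    sum (λ v → sum (λ e → 𝟙 (tgt G e Fin.≟ v) * g v))
      ≡⟨ sum-cong-≗ (λ v → trans (sum-cong-≗ λ e → ℕ.*-comm (𝟙 (tgt G e Fin.≟ v)) (g v))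
           (trans (sym (*-distribˡ-sum (g v) λ e → 𝟙 (tgt G e Fin.≟ v)))
             (trans (ℕ.*-comm (g v) _)
               (cong (_* g v)
                 (trans (sym (count≡sum (λ e → proj₂ e Fin.≟ v) (ends G))) (indegree≡k v)))))) ⟩
    sum (λ v → k * g v)
      ≡⟨ *-distribˡ-sum k g ⟨
    k * sum g ∎
    where open ≡-Reasoning

  automaton-transitive : StronglyConnected G → ∀ (c : IsColoring G χ) u v →
                         ∃ λ w → run (automaton G χ c) w u ≡ v
  automaton-transitive connected c u v = follow (connected u v)
    where
    follow : ∀ {u v} → Star (λ u v → ∃ λ e → src G e ≡ u × tgt G e ≡ v) u v →
             ∃ λ w → run (automaton G χ c) w u ≡ v
    follow ε = [] , refl
    follow ((e , refl , refl) ◅ path)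
      with w , eq ← follow path
      -- Injectivity on outgoing edges identifies the edge that the automaton follows under the
      -- color of `e` with `e` itself.
      with proj₂ c (src G e) (lookup χ e) in eq′
    ... | e′ , s , l = lookup χ e ∷ w ,
      trans (cong (run (automaton G χ c) w)
              (cong (tgt G) (trans (cong proj₁ eq′) (proj₁ c e′ e s l)))) eq

  -- At the sources, properness is part of being a coloring. Two edges of one color with a common
  -- target have sources merged by that letter; letters being injective, the sources agree, and the
  -- source case applies.
  nonSynchronizing⇒latin : (∀ v → indegree G v ≡ k) → StronglyConnected G → Prime (#V G) →
                           NonSynchronizingColoring G χ → Latin (ends G) χ
  nonSynchronizing⇒latin indegree≡k connected pr (c@(inj , surj) , ¬sync) =
    inj , λ e e′ same χ≡ → inj e e′ (nonSynchronizing⇒injective pr ¬sync (lookup χ e)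
      (trans (follows e (lookup χ e) refl)
        (trans same (sym (follows e′ (lookup χ e) (sym χ≡)))))) χ≡
    where
    open Balanced (automaton G χ c)
      (automaton-balanced indegree≡k c) (automaton-transitive connected c)
    follows : ∀ e a → lookup χ e ≡ a → automaton G χ c (src G e) a ≡ tgt G e
    follows e a l with e′ , s′ , l′ ← surj (src G e) a =
      cong (tgt G) (inj e′ e s′ (trans l′ (sym l)))

  run-injective : (c : IsColoring G χ) → Separates (tgt G) (lookup χ) →
                  ∀ w {u v} → run (automaton G χ c) w u ≡ run (automaton G χ c) w v → u ≡ v
  run-injective c            sep []      eq = eq
  run-injective c@(_ , surj) sep (a ∷ w) {u} {v} eq
    with e , s , l ← surj u a | e′ , s′ , l′ ← surj v a
       | eq′ ← run-injective c sep w eq =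
    trans (sym s) (trans (cong (src G) (sep e e′ eq′ (trans l (sym l′)))) s′)

  -- Properness at the targets makes every word injective, whereas a synchronizing word is constant;
  -- a prime number of vertices includes two distinct ones.
  latin⇒nonSynchronizing : IsOut k G → Prime (#V G) → Latin (ends G) χ →
                           NonSynchronizingColoring G χ
  latin⇒nonSynchronizing out pr (sepˢ , sepᵗ) = c , λ (w , one) →
    distinct (#V G) pr λ u v →
      run-injective c sepᵗ w (∣image∣≡1⇒constant (run (automaton G χ c) w) one u v)
    where
    c : IsColoring G χ
    c = sepˢ , λ v → separates⇒hits sepˢ v
          (trans (sym (count≡sum (λ e → proj₁ e Fin.≟ v) (ends G))) (out v))
    distinct : ∀ n → Prime n → ¬ (∀ (u v : Fin n) → u ≡ v)
    distinct 0 pr _ with () ← nonTrivial⇒n>1 0 ⦃ prime⇒nonTrivial pr ⦄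
    distinct 1 pr _ with s≤s () ← nonTrivial⇒n>1 1 ⦃ prime⇒nonTrivial pr ⦄
    distinct (suc (suc n)) _ same with () ← same zero (suc zero)

-- Color classes as perfect matchings

classes : ∀ {k m} → Vec (Fin k) m → Vec (Subset m) k
classes χ = tabulate λ i → tabulate λ e → does (lookup χ e Fin.≟ i)

module _ {k m : ℕ} (χ : Vec (Fin k) m) where

  lookup-classes : ∀ i e → lookup (lookup (classes χ) i) e ≡ does (lookup χ e Fin.≟ i)
  lookup-classes i e = trans
    (cong (λ M → lookup M e) (Vec.lookup∘tabulate _ i)) (Vec.lookup∘tabulate _ e)

  ∈class⁺ : ∀ {i e} → lookup χ e ≡ i → e ∈ lookup (classes χ) i
  ∈class⁺ {i} {e} eq = Vec.lookup⇒[]= e _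
    (trans (lookup-classes i e) (dec-true (lookup χ e Fin.≟ i) eq))

  ∈class⁻ : ∀ {i e} → e ∈ lookup (classes χ) i → lookup χ e ≡ i
  ∈class⁻ {i} {e} e∈ with lookup χ e Fin.≟ i | trans (sym (Vec.[]=⇒lookup e∈)) (lookup-classes i e)
  ... | yes eq | _ = eq

vec-ext : ∀ {A : Set} {n} {xs ys : Vec A n} → (∀ i → lookup xs i ≡ lookup ys i) → xs ≡ ys
vec-ext eq = Pointwise-≡⇒≡ (ext eq)

classes-injective : ∀ {k m} {χ χ′ : Vec (Fin k) m} → classes χ ≡ classes χ′ → χ ≡ χ′
classes-injective {χ = χ} {χ′} eq = vec-ext λ e →
  sym (∈class⁻ χ′ (subst (λ Ms → e ∈ lookup Ms (lookup χ e)) eq (∈class⁺ χ refl)))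

module _ {k m : ℕ} (Ms : Vec (Subset m) k) where

  ∈⋃-toList⁺ : ∀ i {e} → e ∈ lookup Ms i → e ∈ ⋃ (toList Ms)
  ∈⋃-toList⁺ i = x∈⋃⁺ (∈-toList⁺ (vec-∈-lookup i Ms))

  ∈⋃-toList⁻ : ∀ {e} → e ∈ ⋃ (toList Ms) → ∃ λ i → e ∈ lookup Ms i
  ∈⋃-toList⁻ e∈ with _ , M∈ , e∈M ← x∈⋃⁻ (toList Ms) e∈ =
    VecAny.index (∈-toList⁻ M∈) , subst (_ ∈_) (vec-lookup-index (∈-toList⁻ M∈)) e∈M

module _ {k : ℕ} (B : Bipartite) where
  open Bipartite B

  latin⇒oneFactorization : IsRegular k B → (χ : Vec (Fin k) #edges) → Latin joins χ →
                           OneFactorization B (classes χ)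
  latin⇒oneFactorization (regˡ , regʳ) χ (sepˡ , sepʳ) = record
    { perfect  = λ i →
        exactlyOne sepˡ i (λ u → trans (sym (count≡sum (λ e → proj₁ e Fin.≟ u) joins)) (regˡ u)) ,
        exactlyOne sepʳ i (λ w → trans (sym (count≡sum (λ e → proj₂ e Fin.≟ w) joins)) (regʳ w))
    ; disjoint = λ i j i≢j → Subset.Empty-unique λ (e , e∈) →
        let e∈i , e∈j = Subset.x∈p∩q⁻ (lookup (classes χ) i) _ e∈ in
        i≢j (trans (sym (∈class⁻ χ e∈i)) (∈class⁻ χ e∈j))
    ; union    = Subset.⊆-antisym (λ _ → Subset.∈⊤) λ {e} _ →
        ∈⋃-toList⁺ (classes χ) (lookup χ e) (∈class⁺ χ refl)
    }
    where
    exactlyOne : ∀ {p : Fin #edges → Fin size} → Separates p (lookup χ) →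
                 ∀ i → (∀ u → sum (λ e → 𝟙 (p e Fin.≟ u)) ≡ k) →
                 ∀ u → ExactlyOne λ e → e ∈ lookup (classes χ) i × p e ≡ u
    exactlyOne sep i degree u with e , p≡ , χ≡ ← separates⇒hits sep u (degree u) i =
      e , (∈class⁺ χ χ≡ , p≡) , λ e′ (e′∈ , p≡′) →
        sep e′ e (trans p≡′ (sym p≡)) (trans (∈class⁻ χ e′∈) (sym χ≡))

  -- An edge gets the index of a matching that contains it. The union provides such an index,
  -- disjointness makes it unique, and uniqueness within each perfect matching gives properness.
  oneFactorization⇒latin : (Ms : Vec (Subset #edges) k) → OneFactorization B Ms →
                           ∃ λ χ → Latin joins χ × classes χ ≡ Ms
  oneFactorization⇒latin Ms (oneFactorization perfect disjoint union) =
    χ , (separates left (proj₁ ∘ perfect) , separates right (proj₂ ∘ perfect)) ,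
    vec-ext λ i → Subset.⊆-antisym
      (λ e∈ → subst (λ j → _ ∈ lookup Ms j) (∈class⁻ χ e∈) (member _))
      (λ e∈ → ∈class⁺ χ (unique _ _ _ (member _) e∈))
    where
    cover : ∀ e → ∃ λ i → e ∈ lookup Ms i
    cover e = ∈⋃-toList⁻ Ms (subst (e ∈_) (sym union) Subset.∈⊤)
    χ : Vec (Fin k) #edges
    χ = tabulate (proj₁ ∘ cover)
    member : ∀ e → e ∈ lookup Ms (lookup χ e)
    member e = subst (λ j → e ∈ lookup Ms j)
      (sym (Vec.lookup∘tabulate (proj₁ ∘ cover) e)) (proj₂ (cover e))
    unique : ∀ e i j → e ∈ lookup Ms i → e ∈ lookup Ms j → i ≡ j
    unique e i j e∈i e∈j = decidable-stable (i Fin.≟ j) λ i≢j →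
      Subset.∉⊥ (subst (e ∈_) (disjoint i j i≢j) (Subset.x∈p∩q⁺ (e∈i , e∈j)))
    separates : (p : Fin #edges → Fin size) →
                (∀ i u → ExactlyOne λ e → e ∈ lookup Ms i × p e ≡ u) → Separates p (lookup χ)
    separates p exact e e′ p≡ χ≡ with x , _ , only ← exact (lookup χ e) (p e) =
      trans (only e (member e , refl))
            (sym (only e′ (subst (λ j → e′ ∈ lookup Ms j) (sym χ≡) (member e′) , sym p≡)))

#NSC≡#1Fact : ∀ k B → IsRegular k B → Prime (Bipartite.size B) → StronglyConnected (H B) →
              #NSC k (H B) ≡ #1Fact k B
#NSC≡#1Fact k B regular pr connected = filter-bijection
  (nonSynchronizingColoring? (H B)) (oneFactorization? B)
  (allVecs-enumerates (Unique.allFin⁺ k , ∈-allFin) _)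
  (allVecs-enumerates (allVecs-enumerates bits-enumerates _) k)
  classes classes-injective
  (λ χ nsc → latin⇒oneFactorization B regular χ
    (nonSynchronizing⇒latin (H B) χ (proj₂ regular) connected pr nsc))
  λ Ms fact → let χ , latin , eq = oneFactorization⇒latin B Ms fact in
    χ , latin⇒nonSynchronizing (H B) χ (proj₁ regular) pr latin , eq

-- Enlarging the oracle of a reduction

run-oracle : ∀ {M O O′} → (∀ {w a} → O w a → O′ w a) →
             ∀ {q ts n b ts′} → Run M O q ts n b ts′ → Run M O′ q ts n b ts′
run-oracle O⊆O′ (halted eq)     = halted eq
run-oracle O⊆O′ (stepped eq r)  = stepped eq (run-oracle O⊆O′ r)
run-oracle O⊆O′ (asked eq o r)  = asked eq (O⊆O′ o) (run-oracle O⊆O′ r)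

≤ᵀ-oracle : ∀ {Q P P′} → (∀ {w a} → oracleFor P w a → oracleFor P′ w a) → Q ≤ᵀ P → Q ≤ᵀ P′
≤ᵀ-oracle O⊆O′ Q≤P = record
  { machine   = machine
  ; timeBound = timeBound
  ; computes  = λ j → let n , b , ts , r , bounds = computes j in
                      n , b , ts , run-oracle O⊆O′ r , bounds
  }
  where open _≤ᵀ_ Q≤P

nonSynchronizing-hard : ∀ k → SharpPHard (OneFactorizationProblem k) →
                        SharpPHard (NonSynchronizingProblem k)
nonSynchronizing-hard k hard g g∈#P = ≤ᵀ-oracle
  (λ { ((B , regular , pr , connected) , refl , refl) →
       -- `H B` keeps the vector `joins B` as its `ends`, so `regular` also proves it Eulerian and
       -- the codes agree by `refl`.
       (H B , regular , connected , pr) , refl , cong binary (#NSC≡#1Fact k B regular pr connected) })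
  (hard g g∈#P)

-- The verifier

if-true : ∀ {A : Set} {x y : A} {b} → b ≡ true → (if b then x else y) ≡ x
if-true refl = refl

if-false : ∀ {A : Set} {x y : A} {b} → b ≡ false → (if b then x else y) ≡ y
if-false refl = refl

length-unary : ∀ n → length (unary n) ≡ suc n
length-unary zero    = refl
length-unary (suc n) = cong suc (length-unary n)

unary-nonempty : ∀ n {xs} → ∃₂ λ x w → unary n ++ xs ≡ x ∷ w
unary-nonempty zero    = _ , _ , refl
unary-nonempty (suc n) = _ , _ , refl

bits↔Fin : ∀ n → Vec Bool n ↔ Fin (2 ^ n)
bits↔Fin zero    = mk↔ₛ′ (λ _ → zero) (λ _ → []) (λ { zero → refl }) (λ { [] → refl })
bits↔Fin (suc n) = ↔-trans
  (mk↔ₛ′ Vec.uncons (uncurry _∷_) (λ _ → refl) (λ { (b ∷ bs) → refl }))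
  (↔-trans (↔-sym Fin.2↔Bool ×-↔ bits↔Fin n) (↔-sym Fin.*↔×))

-- Tapes as words and as sequences of cells

module _ {A : Set} where

  -- The tail is described through `move goRight`, which is what a machine step produces; matching
  -- on a proof thus runs in lockstep with the machine, whatever lies left of the head.
  data Reads : List Bool → Tape A → Set where
    []  : ∀ {bs cs} → Reads [] (tape bs blank cs)
    _∷_ : ∀ b {w bs cs} → Reads w (move goRight (tape bs (bit b) cs)) →
          Reads (b ∷ w) (tape bs (bit b) cs)

  reads-load : ∀ w → Reads w (load w)
  reads-load []      = []
  reads-load (b ∷ w) = go b w
    where
    go : ∀ b w {bs} → Reads (b ∷ w) (tape bs (bit b) (map bit w))
    go b []       = b ∷ []
    go b (b′ ∷ w) = b ∷ go b′ w

  _[_↦_] : (ℕ → Cell A) → ℕ → Cell A → (ℕ → Cell A)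
  (f [ i ↦ c ]) j = if does (j ℕ.≟ i) then c else f j

  ↦-same : ∀ f i c → (f [ i ↦ c ]) i ≡ c
  ↦-same f i c = cong (if_then c else f i) (dec-true (i ℕ.≟ i) refl)

  ↦-other : ∀ f {i j} c → j ≢ i → (f [ i ↦ c ]) j ≡ f j
  ↦-other f {i} {j} c j≢i = cong (if_then c else f j) (dec-false (j ℕ.≟ i) j≢i)

  data Before (f : ℕ → Cell A) : ℕ → List (Cell A) → Set where
    []  : Before f 0 []
    _∷_ : ∀ {i b bs} → b ≡ f i → Before f i bs → Before f (suc i) (b ∷ bs)

  -- The list may stop early, as the cells of a tape beyond it are blank; `Before`, in contrast, has
  -- exactly `i` entries and so fixes the position of the head.
  data After (f : ℕ → Cell A) (i : ℕ) : List (Cell A) → Set where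
    []  : (∀ j → i ≤ j → f j ≡ blank) → After f i []
    _∷_ : ∀ {c cs} → c ≡ f i → After f (suc i) cs → After f i (c ∷ cs)

  -- On the tape t the head is at position i of the one-way infinite sequence of
  -- cells f.
  record Holds (f : ℕ → Cell A) (i : ℕ) (t : Tape A) : Set where
    constructor holds
    field
      behind : Before f i (Tape.before t)
      under  : Tape.head t ≡ f i
      ahead  : After f (suc i) (Tape.after t)

  before-cong : ∀ {f g i bs} → (∀ j → j < i → f j ≡ g j) → Before f i bs → Before g i bs
  before-cong eq []      = []
  before-cong eq (b ∷ l) =
    trans b (eq _ (ℕ.n<1+n _)) ∷ before-cong (λ j j<i → eq j (ℕ.m<n⇒m<1+n j<i)) l

  after-cong : ∀ {f g i cs} → (∀ j → i ≤ j → f j ≡ g j) → After f i cs → After g i cs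
  after-cong eq ([] bl) = [] λ j i≤j → trans (sym (eq j i≤j)) (bl j i≤j)
  after-cong eq (c ∷ r) =
    trans c (eq _ ℕ.≤-refl) ∷ after-cong (λ j i<j → eq j (ℕ.<⇒≤ i<j)) r

  holds-right : ∀ {f i t} → Holds f i t → Holds f (suc i) (move goRight t)
  holds-right (holds l h ([] bl)) =
    holds (h ∷ l) (sym (bl _ ℕ.≤-refl)) ([] λ j i<j → bl j (ℕ.<⇒≤ i<j))
  holds-right (holds l h (c ∷ r)) = holds (h ∷ l) c r

  holds-left : ∀ {f i t} → Holds f (suc i) t → Holds f i (move goLeft t)
  holds-left (holds (b ∷ l) h r) = holds l b (h ∷ r)

  holds-write : ∀ {f i t} c → Holds f i t →
                Holds (f [ i ↦ c ]) i (tape (Tape.before t) c (Tape.after t))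
  holds-write {f} {i} c (holds l h r) = holds
    (before-cong (λ j j<i → sym (↦-other f c (ℕ.<⇒≢ j<i))) l)
    (sym (↦-same f i c))
    (after-cong (λ j i<j → sym (↦-other f c (ℕ.>⇒≢ i<j))) r)

  isBit : Cell A → Bool
  isBit (bit _) = true
  isBit _       = false

-- A machine that checks edge colorings

module Verifier (κ : ℕ) where

  K : ℕ
  K = suc κ

  Colours : Set
  Colours = Vec Bool (2 * K)

  Side : Set
  Side = Fin 2

  Cells : Set
  Cells = ℕ → Cell Colours

  State : Set
  State = Fin 5 × Side × Fin K

  -- The machine skips the vertex number; for each edge it reads a color c from the
  -- certificate, written in unary as κ ∸ c ones and a zero, and then, for the
  -- source (side 0) and the target (side 1), seeks the cell of that vertex on the
  -- work tape, records c in it, and rewinds; at last it checks that the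
  -- certificate is padded by zeros. The work tape holds a bit at position 0, where
  -- rewinding stops, and the set of colors seen on both sides of the vertex v at
  -- position v + 1.
  pattern skipping  = 0F
  pattern colouring = 1F
  pattern seeking   = 2F
  pattern rewinding = 3F
  pattern padding   = 4F

  -- Start of the countdown by which a color is read: each one in the certificate lowers the counter
  -- by one.
  top : Fin K
  top = fromℕ κ

  colours : Cell Colours → Colours
  colours (mark p) = p
  colours _        = Vec.replicate _ false

  include : Side → Fin K → Cell Colours → Cell Colours
  include s c z = mark (colours z [ combine s c ]≔ true)

  afterVisit : Side → Fin K → State
  afterVisit 0F c = seeking , 1F , c
  afterVisit 1F c = colouring , 0F , top

  transition : State → Vec (Cell Colours) 3 → Action State Colours 3
  transition (skipping , q) (x@(bit true) ∷ y ∷ z ∷ []) =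
    step (skipping , q) ((x , goRight) ∷ (y , stay) ∷ (z , stay) ∷ [])
  -- The vertex number ends here: the origin of the work tape gets its bit, and the head moves on to
  -- the cell of vertex 0.
  transition (skipping , q) (x@(bit false) ∷ y ∷ z ∷ []) =
    step (colouring , 0F , top) ((x , goRight) ∷ (y , stay) ∷ (bit true , goRight) ∷ [])
  transition (colouring , q) (x@blank ∷ y ∷ z ∷ []) =
    step (padding , q) ((x , stay) ∷ (y , stay) ∷ (z , stay) ∷ [])
  transition (colouring , s , c) (x@(bit _) ∷ y@(bit false) ∷ z ∷ []) =
    step (seeking , 0F , c) ((x , stay) ∷ (y , goRight) ∷ (z , stay) ∷ [])
  transition (colouring , s , suc c) (x@(bit _) ∷ y@(bit true) ∷ z ∷ []) =
    step (colouring , s , inject₁ c) ((x , stay) ∷ (y , goRight) ∷ (z , stay) ∷ [])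
  transition (seeking , q) (x@(bit true) ∷ y ∷ z ∷ []) =
    step (seeking , q) ((x , goRight) ∷ (y , stay) ∷ (z , goRight) ∷ [])
  transition (seeking , s , c) (x@(bit false) ∷ y ∷ z ∷ []) =
    if lookup (colours z) (combine s c) then halt false else
    step (rewinding , s , c) ((x , goRight) ∷ (y , stay) ∷ (include s c z , goLeft) ∷ [])
  transition (rewinding , s , c) (x ∷ y ∷ z ∷ []) =
    if isBit z
    then step (afterVisit s c) ((x , stay) ∷ (y , stay) ∷ (z , goRight) ∷ [])
    else step (rewinding , s , c) ((x , stay) ∷ (y , stay) ∷ (z , goLeft) ∷ [])
  transition (padding , q) (x ∷ y@(bit false) ∷ z ∷ []) =
    step (padding , q) ((x , stay) ∷ (y , goRight) ∷ (z , stay) ∷ [])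
  transition (padding , q) (x ∷ blank ∷ z ∷ []) = halt true
  -- Three of the remaining cases can occur on codes of graphs: a one when the counter is at zero, a
  -- certificate that ends before a color is complete, and a one in the padding.
  transition _ _ = halt false

  machine : Machine
  machine = record
    { State       = State
    ; Mark        = Colours
    ; finiteState = _ , ↔-trans (↔-refl ×-↔ ↔-sym Fin.*↔×) (↔-sym Fin.*↔×)
    ; finiteMark  = _ , bits↔Fin (2 * K)
    ; #work       = 1
    ; initial     = skipping , 0F , top
    ; δ           = transition
    }

  record Finishes (q : State) (ts : Machine.Tapes machine) (t : ℕ) (b : Bool) : Set where
    constructor finishes
    field
      {time}   : ℕ
      {tapes}  : Machine.Tapes machine
      computes : Run machine noOracle q ts time b tapes
      within   : time ≤ t

  finishes-≤ : ∀ {q ts t t′ b} → t ≤ t′ → Finishes q ts t b → Finishes q ts t′ b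
  finishes-≤ t≤t′ (finishes r n≤t) = finishes r (ℕ.≤-trans n≤t t≤t′)

  halts : ∀ {q ts t b} → transition q (Vec.map Tape.head ts) ≡ halt b → Finishes q ts t b
  halts eq = finishes (halted eq) z≤n

  steps : ∀ {q q′ ts ms t b} → transition q (Vec.map Tape.head ts) ≡ step q′ ms →
          Finishes q′ (Vec.zipWith writeMove ms ts) t b → Finishes q ts (suc t) b
  steps eq (finishes r n≤t) = finishes (stepped eq r) (s≤s n≤t)

  parse : Fin K → List Bool → Maybe (Fin K × List Bool)
  parse c       []           = nothing
  parse c       (false ∷ ys) = just (c , ys)
  parse zero    (true ∷ ys)  = nothing
  parse (suc c) (true ∷ ys)  = parse (inject₁ c) ys

  used : Cells → ℕ → Side → Fin K → Bool
  used f v s c = lookup (colours (f (suc v))) (combine s c)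

  visit : Cells → ℕ → Side → Fin K → Cells
  visit f v s c = f [ suc v ↦ include s c (f (suc v)) ]

  -- Functional model of the run from the first edge on, linked to the machine by `edges-run`; which
  -- certificates it accepts can be studied without tapes.
  check : ∀ {n m} → Cells → Vec (Fin n × Fin n) m → List Bool → Bool
  check f [] ys = all not ys
  check f ((u , v) ∷ es) ys with parse top ys
  ... | nothing = false
  ... | just (c , ys′) =
    if used f (toℕ u) 0F c then false else
    if used f₁ (toℕ v) 1F c then false else
    check (visit f₁ (toℕ v) 1F c) es ys′
    where f₁ = visit f (toℕ u) 0F c

  record Delimited (f : Cells) : Set where
    constructor delimited
    field
      origin : isBit (f 0) ≡ true
      rest   : ∀ i → isBit (f (suc i)) ≡ false

  delimited-visit : ∀ {f} v s c → Delimited f → Delimited (visit f v s c)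
  delimited-visit {f} v s c (delimited origin rest) = delimited origin λ i → go i (i ℕ.≟ v)
    where
    go : ∀ i → Dec (i ≡ v) → isBit (visit f v s c (suc i)) ≡ false
    go i (yes refl) = cong isBit (↦-same f (suc v) _)
    go i (no i≢v)   = trans (cong isBit (↦-other f _ (i≢v ∘ ℕ.suc-injective))) (rest i)

  -- Tracing the phases of the machine

  padding-run : ∀ {q t₀ t₁ t₂ ys} → Reads ys t₁ →
                Finishes (padding , q) (t₀ ∷ t₁ ∷ t₂ ∷ []) (length ys) (all not ys)
  padding-run []          = halts refl
  padding-run (true ∷ r)  = halts refl
  padding-run (false ∷ r) = steps refl (padding-run r)

  -- The phases are traced in continuation style: `next` is the rest of the run from any tapes
  -- satisfying the invariants, and its time bound `t` is added to that of the phase.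
  skipping-run : ∀ n {q w t₀ t₁ t₂ t b} → Reads (unary n ++ w) t₀ → Holds (λ _ → blank) 0 t₂ →
    (∀ {t₀′ t₂′} → Reads w t₀′ → Holds ((λ _ → blank) [ 0 ↦ bit true ]) 1 t₂′ →
      Finishes (colouring , 0F , top) (t₀′ ∷ t₁ ∷ t₂′ ∷ []) t b) →
    Finishes (skipping , q) (t₀ ∷ t₁ ∷ t₂ ∷ []) (suc n + t) b
  skipping-run zero    (false ∷ r) h next =
    steps refl (next r (holds-right (holds-write (bit true) h)))
  skipping-run (suc n) (true ∷ r)  h next = steps refl (skipping-run n r h next)

  rewinding-run : ∀ i {f s c t₀ t₁ t₂ t b} → Delimited f → Holds f i t₂ →
    (∀ {t₂′} → Holds f 1 t₂′ → Finishes (afterVisit s c) (t₀ ∷ t₁ ∷ t₂′ ∷ []) t b) →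
    Finishes (rewinding , s , c) (t₀ ∷ t₁ ∷ t₂ ∷ []) (suc i + t) b
  rewinding-run zero d h next = steps
    (if-true (trans (cong isBit (Holds.under h)) (Delimited.origin d)))
    (next (holds-right h))
  rewinding-run (suc i) d h next = steps
    (if-false (trans (cong isBit (Holds.under h)) (Delimited.rest d i)))
    (rewinding-run i d (holds-left h) next)

  module _ {f : Cells} {s : Side} {c : Fin K} (d : Delimited f) (v : ℕ) where

    -- While `u` ones are still to be read, the head is on the cell of vertex `i`, so `u + i` is
    -- invariant. Recording the color moves the head back to position `v`, from where rewinding
    -- takes `suc v` steps.
    seeking-run : ∀ u {i w t₀ t₁ t₂ t b} → u + i ≡ v →
      Reads (unary u ++ w) t₀ → Holds f (suc i) t₂ →
      (used f v s c ≡ true → b ≡ false) →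
      (used f v s c ≡ false → ∀ {t₀′ t₂′} → Reads w t₀′ → Holds (visit f v s c) 1 t₂′ →
        Finishes (afterVisit s c) (t₀′ ∷ t₁ ∷ t₂′ ∷ []) t b) →
      Finishes (seeking , s , c) (t₀ ∷ t₁ ∷ t₂ ∷ []) (suc u + (suc v + t)) b
    seeking-run (suc u) {i} eq (true ∷ r) h reject next =
      steps refl (seeking-run u (trans (ℕ.+-suc u i) eq) r (holds-right h) reject next)
    seeking-run zero {t₂ = t₂} refl (false ∷ r) h reject next
      with used f v s c in eq
    ... | true  = halts (trans
      (if-true (trans (cong (λ z → lookup (colours z) (combine s c)) (Holds.under h)) eq))
      (cong halt (sym (reject refl))))
    ... | false = steps
      (if-false (trans (cong (λ z → lookup (colours z) (combine s c)) (Holds.under h)) eq))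
      (rewinding-run v (delimited-visit v s c d) (holds-left written) (next refl r))
      where
      written : Holds (visit f v s c) (suc v)
                      (tape (Tape.before t₂) (include s c (Tape.head t₂)) (Tape.after t₂))
      written = subst
        (λ z → Holds (visit f v s c) (suc v) (tape (Tape.before t₂) z (Tape.after t₂)))
        (cong (include s c) (sym (Holds.under h))) (holds-write (include s c (f (suc v))) h)

  -- Each step reads one certificate bit, so the bound trades the length of `ys` for that of `ys′`.
  -- The input must show a bit `x`: a blank would mean that no edge remains.
  colouring-run : ∀ c {w t₀ t₁ t₂ t b x ys} → Reads (x ∷ w) t₀ → Reads ys t₁ →
    (parse c ys ≡ nothing → b ≡ false) →
    (∀ {a ys′ t₁′} → parse c ys ≡ just (a , ys′) → Reads ys′ t₁′ →
      Finishes (seeking , 0F , a) (t₀ ∷ t₁′ ∷ t₂ ∷ []) (length ys′ + t) b) →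
    Finishes (colouring , 0F , c) (t₀ ∷ t₁ ∷ t₂ ∷ []) (length ys + t) b
  colouring-run zero    (x ∷ _) []          reject next = halts (cong halt (sym (reject refl)))
  colouring-run (suc c) (x ∷ _) []          reject next = halts (cong halt (sym (reject refl)))
  colouring-run zero    (x ∷ _) (true ∷ r)  reject next = halts (cong halt (sym (reject refl)))
  colouring-run (suc c) r₀@(x ∷ _) (true ∷ r) reject next =
    steps refl (colouring-run (inject₁ c) r₀ r reject next)
  colouring-run zero    (x ∷ _) (false ∷ r) reject next = steps refl (next refl r)
  colouring-run (suc c) (x ∷ _) (false ∷ r) reject next = steps refl (next refl r)

  encodeEnds : ∀ {n m} → Vec (Fin n × Fin n) m → List Bool
  encodeEnds es = concatMap encodePair (toList es)

  -- Every bit of an endpoint is paid for twice, once in seeking and once in rewinding; the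
  -- certificate is read once, and the extra step enters the padding phase.
  edges-run : ∀ {n m} (es : Vec (Fin n × Fin n) m) {f t₀ t₁ t₂ ys} → Delimited f →
    Reads (encodeEnds es) t₀ → Reads ys t₁ → Holds f 1 t₂ →
    Finishes (colouring , 0F , top) (t₀ ∷ t₁ ∷ t₂ ∷ [])
             (length ys + suc (2 * length (encodeEnds es))) (check f es ys)
  edges-run [] {ys = ys} d [] r₁ h =
    finishes-≤ (ℕ.≤-reflexive (ℕ.+-comm 1 (length ys))) (steps refl (padding-run r₁))
  edges-run {n} ((u , v) ∷ es) {f} {t₀} {t₁} {t₂} {ys} d r₀ r₁ h
    with x , w , eq ← unary-nonempty (toℕ u) {unary (toℕ v) ++ encodeEnds es} =
    finishes-≤ (ℕ.≤-reflexive bound)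
      (colouring-run top (subst (λ w → Reads w t₀) eq r₀′) r₁ reject next)
    where
    r₀′ : Reads (unary (toℕ u) ++ (unary (toℕ v) ++ encodeEnds es)) t₀
    r₀′ = subst (λ w → Reads w t₀) (++-assoc (unary (toℕ u)) _ _) r₀
    ℓ : ℕ
    ℓ = suc (2 * length (encodeEnds es))
    T₁ T₂ : ℕ
    T₁ = suc (toℕ v) + (suc (toℕ v) + ℓ)
    T₂ = suc (toℕ u) + (suc (toℕ u) + T₁)
    reject : parse top ys ≡ nothing → check f ((u , v) ∷ es) ys ≡ false
    reject eq rewrite eq = refl
    next : ∀ {c ys′ t₁′} → parse top ys ≡ just (c , ys′) → Reads ys′ t₁′ →
           Finishes (seeking , 0F , c) (t₀ ∷ t₁′ ∷ t₂ ∷ []) (length ys′ + T₂)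
                    (check f ((u , v) ∷ es) ys)
    next {c} {ys′} eq r₁ rewrite eq = finishes-≤
      (ℕ.≤-reflexive (shuffle (toℕ u) (toℕ v) (length ys′) ℓ))
      (seeking-run d (toℕ u) (toℕ u) (ℕ.+-identityʳ _) r₀′ h if-true
        λ eq r₀ h → subst (Finishes _ _ _) (sym (if-false eq))
          (seeking-run (delimited-visit (toℕ u) 0F c d) (toℕ v) (toℕ v) (ℕ.+-identityʳ _) r₀ h
            if-true
            λ eq r₀ h → subst (Finishes _ _ _) (sym (if-false eq))
              (edges-run es (delimited-visit (toℕ v) 1F c (delimited-visit (toℕ u) 0F c d))
                r₀ r₁ h)))
      where
      shuffle : ∀ u v y l → suc u + (suc u + (suc v + (suc v + (y + l)))) ≡
                            y + (suc u + (suc u + (suc v + (suc v + l))))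
      shuffle = solve 4 (λ u v y l →
        (con 1 :+ u) :+ ((con 1 :+ u) :+ ((con 1 :+ v) :+ ((con 1 :+ v) :+ (y :+ l)))) :=
          y :+ ((con 1 :+ u) :+ ((con 1 :+ u) :+ ((con 1 :+ v) :+ ((con 1 :+ v) :+ l))))) refl
        where open +-*-Solver
    bound : length ys + T₂ ≡ length ys + suc (2 * length (encodeEnds ((u , v) ∷ es)))
    bound = cong (length ys +_) (trans (shuffle (toℕ u) (toℕ v) (length (encodeEnds es)))
      (cong (λ l → suc (2 * l)) (sym (trans (length-++ (encodePair (u , v)))
        (cong (_+ length (encodeEnds es)) (trans (length-++ (unary (toℕ u)))
          (cong₂ _+_ (length-unary (toℕ u)) (length-unary (toℕ v)))))))))
      where
      shuffle : ∀ u v l → suc u + (suc u + (suc v + (suc v + suc (2 * l)))) ≡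
                          suc (2 * (suc u + suc v + l))
      shuffle = solve 3 (λ u v l →
        (con 1 :+ u) :+ ((con 1 :+ u) :+ ((con 1 :+ v) :+ ((con 1 :+ v) :+
          (con 1 :+ con 2 :* l)))) :=
          con 1 :+ con 2 :* ((con 1 :+ u) :+ (con 1 :+ v) :+ l)) refl
        where open +-*-Solver

  -- Unary codes of colors

  code : Fin K → List Bool
  code c = replicate (κ ∸ toℕ c) true ++ false ∷ []

  codes : ∀ {m} → Vec (Fin K) m → List Bool
  codes χ = concatMap code (toList χ)

  -- Invariant of the countdown: the counter is the final color plus the number `j` of ones still to
  -- come.
  parse-run : ∀ j c a {ys} → toℕ c ≡ j + toℕ a →
              parse c ((replicate j true ++ false ∷ []) ++ ys) ≡ just (a , ys)
  parse-run zero    zero    a eq = cong (λ a → just (a , _)) (Fin.toℕ-injective eq)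
  parse-run zero    (suc c) a eq = cong (λ a → just (a , _)) (Fin.toℕ-injective eq)
  parse-run (suc j) (suc c) a eq =
    parse-run j (inject₁ c) a (trans (Fin.toℕ-inject₁ c) (ℕ.suc-injective eq))

  parse-code : ∀ c {ys} → parse top (code c ++ ys) ≡ just (c , ys)
  parse-code c = parse-run (κ ∸ toℕ c) top c
    (trans (Fin.toℕ-fromℕ κ) (sym (ℕ.m∸n+n≡m (Fin.toℕ≤pred[n] c))))

  parse-codes : ∀ {m} c (χ : Vec (Fin K) m) ys →
                parse top (codes (c ∷ χ) ++ ys) ≡ just (c , codes χ ++ ys)
  parse-codes c χ ys = trans (cong (parse top) (++-assoc (code c) (codes χ) ys)) (parse-code c)

  parse-sound : ∀ c ys {a ys′} → parse c ys ≡ just (a , ys′) →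
                ∃ λ j → toℕ c ≡ j + toℕ a × ys ≡ (replicate j true ++ false ∷ []) ++ ys′
  parse-sound zero    (false ∷ ys) refl = 0 , refl , refl
  parse-sound (suc c) (false ∷ ys) refl = 0 , refl , refl
  parse-sound (suc c) (true ∷ ys)  eq with j , c≡ , ys≡ ← parse-sound (inject₁ c) ys eq =
    suc j , cong suc (trans (sym (Fin.toℕ-inject₁ c)) c≡) , cong (true ∷_) ys≡

  parse-top-sound : ∀ ys {a ys′} → parse top ys ≡ just (a , ys′) → ys ≡ code a ++ ys′
  parse-top-sound ys {a} {ys′} eq with j , top≡ , refl ← parse-sound top ys eq =
    cong (λ j → (replicate j true ++ false ∷ []) ++ ys′) (begin
      j                  ≡⟨ ℕ.m+n∸n≡m j (toℕ a) ⟨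
      j + toℕ a ∸ toℕ a  ≡⟨ cong (_∸ toℕ a) top≡ ⟨
      toℕ top ∸ toℕ a    ≡⟨ cong (_∸ toℕ a) (Fin.toℕ-fromℕ κ) ⟩
      κ ∸ toℕ a          ∎)
    where open ≡-Reasoning

  initialCells : Cells
  initialCells = (λ _ → blank) [ 0 ↦ bit true ]

  -- Acceptance and properness

  module _ {n : ℕ} where

    visitBoth : Cells → Fin n × Fin n → Fin K → Cells
    visitBoth f (u , v) c = visit (visit f (toℕ u) 0F c) (toℕ v) 1F c

    Fits : ∀ {m} → Cells → Vec (Fin n × Fin n) m → Vec (Fin K) m → Set
    Fits f []             []      = ⊤
    Fits f ((u , v) ∷ es) (c ∷ χ) =
      used f (toℕ u) 0F c ≡ false × used (visit f (toℕ u) 0F c) (toℕ v) 1F c ≡ false ×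
      Fits (visitBoth f (u , v) c) es χ

    all-not⇒replicate : ∀ ys → all not ys ≡ true → ∃ λ j → ys ≡ replicate j false
    all-not⇒replicate []           _  = 0 , refl
    all-not⇒replicate (false ∷ ys) eq with j , ys≡ ← all-not⇒replicate ys eq =
      suc j , cong (false ∷_) ys≡

    all-not-replicate : ∀ j → all not (replicate j false) ≡ true
    all-not-replicate zero    = refl
    all-not-replicate (suc j) = all-not-replicate j

    check-sound : ∀ {m} f (es : Vec (Fin n × Fin n) m) ys → check f es ys ≡ true →
                  ∃₂ λ χ j → Fits f es χ × ys ≡ codes χ ++ replicate j false
    check-sound f [] ys eq with j , ys≡ ← all-not⇒replicate ys eq = [] , j , _ , ys≡
    check-sound f ((u , v) ∷ es) ys eq with parse top ys in parsed
    ... | just (c , ys′) with used f (toℕ u) 0F c in fresh₀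
    ...   | false with used (visit f (toℕ u) 0F c) (toℕ v) 1F c in fresh₁
    ...     | false with χ , j , fits , refl ← check-sound (visitBoth f (u , v) c) es ys′ eq =
      c ∷ χ , j , (fresh₀ , fresh₁ , fits) ,
      trans (parse-top-sound ys parsed) (sym (++-assoc (code c) (codes χ) _))

    check-complete : ∀ {m} f (es : Vec (Fin n × Fin n) m) χ j → Fits f es χ →
                     check f es (codes χ ++ replicate j false) ≡ true
    check-complete f [] [] j _ = all-not-replicate j
    check-complete f ((u , v) ∷ es) (c ∷ χ) j (fresh₀ , fresh₁ , fits)
      rewrite parse-codes c χ (replicate j false) | fresh₀ | fresh₁ =
      check-complete (visitBoth f (u , v) c) es χ j fits

    end : Side → Fin n × Fin n → Fin n
    end 0F = proj₁
    end 1F = proj₂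

    ColoursUnused : ∀ {m} → Cells → Vec (Fin n × Fin n) m → Vec (Fin K) m → Set
    ColoursUnused f es χ = ∀ s e → used f (toℕ (end s (lookup es e))) s (lookup χ e) ≡ false

    SeparatesEnds : ∀ {m} → Vec (Fin n × Fin n) m → Vec (Fin K) m → Set
    SeparatesEnds es χ = ∀ s → Separates (end s ∘ lookup es) (lookup χ)

    used-visit-same : ∀ f v s c → used (visit f v s c) v s c ≡ true
    used-visit-same f v s c = trans
      (cong (λ z → lookup (colours z) (combine s c)) (↦-same f (suc v) _))
      (Vec.lookup∘update (combine s c) (colours (f (suc v))) true)

    -- Different vertices have different cells, and within a cell `combine` gives each pair of side
    -- and color its own bit.
    used-visit-other : ∀ f v s c w s′ c′ → ¬ (w ≡ v × s′ ≡ s × c′ ≡ c) →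
                       used (visit f v s c) w s′ c′ ≡ used f w s′ c′
    used-visit-other f v s c w s′ c′ other with w ℕ.≟ v
    ... | no w≢v =
      cong (λ z → lookup (colours z) (combine s′ c′)) (↦-other f _ (w≢v ∘ ℕ.suc-injective))
    ... | yes refl = trans
      (cong (λ z → lookup (colours z) (combine s′ c′)) (↦-same f (suc v) _))
      (Vec.lookup∘update′ (λ eq → other (refl , Fin.combine-injective s′ c′ s c eq))
        (colours (f (suc v))) true)

    module _ (f : Cells) (e : Fin n × Fin n) (c : Fin K) where

      private
        u v : ℕ
        u = toℕ (proj₁ e)
        v = toℕ (proj₂ e)
        f₁ : Cells
        f₁ = visit f u 0F c

      used-visitBoth-same : ∀ s → used (visitBoth f e c) (toℕ (end s e)) s c ≡ true
      used-visitBoth-same 0F = trans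
        (used-visit-other f₁ v 1F c u 0F c λ { (_ , () , _) }) (used-visit-same f u 0F c)
      used-visitBoth-same 1F = used-visit-same f₁ v 1F c

      used-visitBoth-other : ∀ s {w c′} → ¬ (end s e ≡ w × c ≡ c′) →
                             used (visitBoth f e c) (toℕ w) s c′ ≡ used f (toℕ w) s c′
      used-visitBoth-other 0F {w} {c′} other = trans
        (used-visit-other f₁ v 1F c (toℕ w) 0F c′ λ { (_ , () , _) })
        (used-visit-other f u 0F c (toℕ w) 0F c′ λ { (w≡ , _ , c≡) →
          other (Fin.toℕ-injective (sym w≡) , sym c≡) })
      used-visitBoth-other 1F {w} {c′} other = trans
        (used-visit-other f₁ v 1F c (toℕ w) 1F c′ λ { (w≡ , _ , c≡) →
          other (Fin.toℕ-injective (sym w≡) , sym c≡) })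
        (used-visit-other f u 0F c (toℕ w) 1F c′ λ { (_ , () , _) })

      -- At a loop both visits go to the same cell, but the bit of side 0 is not that of side 1.
      used-visit-second : used f₁ v 1F c ≡ used f v 1F c
      used-visit-second = used-visit-other f u 0F c v 1F c λ { (_ , () , _) }

      used-visitBoth-false : ∀ s {w c′} → used (visitBoth f e c) (toℕ w) s c′ ≡ false →
                             ¬ (end s e ≡ w × c ≡ c′)
      used-visitBoth-false s eq (refl , refl) with () ← trans (sym eq) (used-visitBoth-same s)

    -- Earlier edges have left colors in `f`, so the induction pairs properness of the remaining
    -- edges with `ColoursUnused`, which holds trivially for `initialCells`.
    fits⇒separates : ∀ {m} f (es : Vec (Fin n × Fin n) m) χ → Fits f es χ →
                     SeparatesEnds es χ × ColoursUnused f es χ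
    fits⇒separates f [] [] _ = (λ _ ()) , λ _ ()
    fits⇒separates f (e ∷ es) (c ∷ χ) (fresh₀ , fresh₁ , fits)
      with sep , unused ← fits⇒separates (visitBoth f e c) es χ fits = separates , unusedColours
      where
      separates : SeparatesEnds (e ∷ es) (c ∷ χ)
      separates s zero    zero     _  _  = refl
      separates s zero    (suc i′) p≡ χ≡ =
        contradiction (p≡ , χ≡) (used-visitBoth-false f e c s (unused s i′))
      separates s (suc i) zero     p≡ χ≡ =
        contradiction (sym p≡ , sym χ≡) (used-visitBoth-false f e c s (unused s i))
      separates s (suc i) (suc i′) p≡ χ≡ = cong suc (sep s i i′ p≡ χ≡)
      unusedColours : ColoursUnused f (e ∷ es) (c ∷ χ)
      unusedColours 0F zero    = fresh₀
      unusedColours 1F zero    = trans (sym (used-visit-second f e c)) fresh₁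
      unusedColours s  (suc i) = trans
        (sym (used-visitBoth-other f e c s (used-visitBoth-false f e c s (unused s i))))
        (unused s i)

    separates⇒fits : ∀ {m} f (es : Vec (Fin n × Fin n) m) χ →
                     SeparatesEnds es χ → ColoursUnused f es χ → Fits f es χ
    separates⇒fits f [] [] _ _ = _
    separates⇒fits f (e ∷ es) (c ∷ χ) sep unused =
      unused 0F zero ,
      trans (used-visit-second f e c) (unused 1F zero) ,
      separates⇒fits (visitBoth f e c) es χ
        (λ s i i′ p≡ χ≡ → Fin.suc-injective (sep s (suc i) (suc i′) p≡ χ≡))
        (λ s i → trans
          (used-visitBoth-other f e c s λ { (p≡ , χ≡) → Fin.0≢1+n (sep s zero (suc i) p≡ χ≡) })
          (unused s (suc i)))

    fits⇒latin : ∀ {m} (es : Vec (Fin n × Fin n) m) χ → Fits initialCells es χ → Latin es χ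
    fits⇒latin es χ fits with sep , _ ← fits⇒separates initialCells es χ fits = sep 0F , sep 1F

    latin⇒fits : ∀ {m} (es : Vec (Fin n × Fin n) m) χ → Latin es χ → Fits initialCells es χ
    latin⇒fits es χ (sep₀ , sep₁) = separates⇒fits initialCells es χ
      (λ { 0F → sep₀ ; 1F → sep₁ })
      λ s e → Vec.lookup-replicate (combine s (lookup χ e)) false

  -- Padding to certificates of fixed length

  certificate : ∀ l → List Bool → Vec Bool l
  -- Only words longer than the given length are cut off here; `codes≤L` keeps the codes of
  -- colorings short enough.
  certificate zero    _        = []
  certificate (suc l) []       = false ∷ certificate l []
  certificate (suc l) (b ∷ bs) = b ∷ certificate l bs

  certificate-padding : ∀ l bs → length bs ≤ l →
                        ∃ λ j → toList (certificate l bs) ≡ bs ++ replicate j false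
  certificate-padding zero    []       _   = 0 , refl
  certificate-padding (suc l) []       _   with j , eq ← certificate-padding l [] z≤n =
    suc j , cong (false ∷_) eq
  certificate-padding (suc l) (b ∷ bs) bs≤ with j , eq ← certificate-padding l bs (ℕ.≤-pred bs≤) =
    j , cong (b ∷_) eq

  certificate-unique : ∀ {l} (y : Vec Bool l) bs j → toList y ≡ bs ++ replicate j false →
                       certificate l bs ≡ y
  certificate-unique []      bs       j       eq = refl
  certificate-unique (b ∷ y) []       (suc j) eq =
    cong₂ _∷_ (sym (∷-injectiveˡ eq)) (certificate-unique y [] j (∷-injectiveʳ eq))
  certificate-unique (b ∷ y) (x ∷ bs) j       eq =
    cong₂ _∷_ (sym (∷-injectiveˡ eq)) (certificate-unique y bs j (∷-injectiveʳ eq))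

  -- `parse top` recovers the first color whatever follows it, so the codes form a prefix code and
  -- the tails `xs` and `ys` may differ.
  codes-injective : ∀ {m} (χ χ′ : Vec (Fin K) m) {xs ys} → codes χ ++ xs ≡ codes χ′ ++ ys → χ ≡ χ′
  codes-injective []      []        eq = refl
  codes-injective (c ∷ χ) (c′ ∷ χ′) {xs} {ys} eq
    with refl , eq′ ← ,-injective (just-injective
           (trans (sym (parse-codes c χ xs))
             (trans (cong (parse top) eq) (parse-codes c′ χ′ ys)))) =
    cong (c ∷_) (codes-injective χ χ′ eq′)

  -- Lengths and running time

  length-codes : ∀ {m} (χ : Vec (Fin K) m) → length (codes χ) ≤ m * K
  length-codes []      = z≤n
  length-codes (c ∷ χ) =
    ℕ.≤-trans (ℕ.≤-reflexive (length-++ (code c))) (ℕ.+-mono-≤ code≤K (length-codes χ))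
    where
    open ℕ.≤-Reasoning
    code≤K : length (code c) ≤ K
    code≤K = begin
      length (code c)                          ≡⟨ length-++ (replicate (κ ∸ toℕ c) true) ⟩
      length (replicate (κ ∸ toℕ c) true) + 1  ≡⟨ cong (_+ 1) (length-replicate (κ ∸ toℕ c)) ⟩
      κ ∸ toℕ c + 1                            ≡⟨ ℕ.+-comm _ 1 ⟩
      suc (κ ∸ toℕ c)                          ≤⟨ s≤s (ℕ.m∸n≤m κ (toℕ c)) ⟩
      K                                        ∎

  length-encodeEnds : ∀ {n m} (es : Vec (Fin n × Fin n) m) → m ≤ length (encodeEnds es)
  length-encodeEnds [] = z≤n
  length-encodeEnds ((u , v) ∷ es) with x , w , eq ← unary-nonempty (toℕ u) {unary (toℕ v)} = begin
    suc _                                             ≤⟨ s≤s (length-encodeEnds es) ⟩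
    suc (length (encodeEnds es))                      ≤⟨ s≤s (ℕ.m≤n+m _ (length w)) ⟩
    suc (length w + length (encodeEnds es))           ≡⟨ cong (λ z → length z + length (encodeEnds es)) eq ⟨
    length (encodePair (u , v)) + length (encodeEnds es) ≡⟨ length-++ (encodePair (u , v)) ⟨
    length (encodeEnds ((u , v) ∷ es))                ∎
    where open ℕ.≤-Reasoning

  -- An input of length `N` has at most `N` edges, each with a color code of at most `K` bits. The
  -- time is linear: `K * N` steps for the certificate and at most `2 * N + 1` for the rest.
  certLength timeBound : Polynomial
  certLength = 0 ∷ K ∷ []
  timeBound  = 1 ∷ K + 2 ∷ []

  module _ (G : Digraph) where

    private
      N : ℕ
      N = length (encodeDigraph G)
      L : ℕ
      L = ⟦ certLength ⟧ N

    N≡ : N ≡ suc (#V G) + length (encodeEnds (ends G))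
    N≡ = trans (length-++ (unary (#V G)))
               (cong (_+ length (encodeEnds (ends G))) (length-unary (#V G)))

    accepts : Vec Bool L → Bool
    accepts y = check initialCells (ends G) (toList y)

    decides : (y : Vec Bool L) →
      Finishes (Machine.initial machine) (Machine.start machine (encodeDigraph G) (toList y))
               (⟦ timeBound ⟧ N) (accepts y)
    decides y = finishes-≤ bound
      (skipping-run (#V G) (reads-load (encodeDigraph G)) (holds [] refl ([] λ _ _ → refl)) λ r h →
        edges-run (ends G) (delimited refl λ _ → refl) r (reads-load (toList y)) h)
      where
      open ℕ.≤-Reasoning
      arithmetic : ∀ n l k → suc n + ((suc n + l) * (k + (suc n + l) * 0) + suc (2 * l)) ≤
                             1 + (suc n + l) * (k + 2 + (suc n + l) * 0)
      arithmetic n l k = ℕ.≤-trans (ℕ.m≤m+n _ (suc n)) (ℕ.≤-reflexive (solve 3 (λ n l k →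
        (con 1 :+ n) :+ ((con 1 :+ n :+ l) :* (k :+ (con 1 :+ n :+ l) :* con 0) :+
          (con 1 :+ con 2 :* l)) :+ (con 1 :+ n)
        := con 1 :+ (con 1 :+ n :+ l) :* (k :+ con 2 :+ (con 1 :+ n :+ l) :* con 0)) refl n l k))
        where open +-*-Solver
      bound : suc (#V G) + (length (toList y) + suc (2 * length (encodeEnds (ends G)))) ≤
              ⟦ timeBound ⟧ N
      bound = begin
        suc (#V G) + (length (toList y) + suc (2 * length (encodeEnds (ends G))))
          ≡⟨ cong (λ l → suc (#V G) + (l + suc (2 * length (encodeEnds (ends G))))) (Vec.length-toList y) ⟩
        suc (#V G) + (N * (K + N * 0) + suc (2 * length (encodeEnds (ends G))))
          ≡⟨ cong (λ N → suc (#V G) + (N * (K + N * 0) + suc (2 * length (encodeEnds (ends G))))) N≡ ⟩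
        _ ≤⟨ arithmetic (#V G) (length (encodeEnds (ends G))) K ⟩
        _ ≡⟨ cong (λ N → 1 + N * (K + 2 + N * 0)) N≡ ⟨
        ⟦ timeBound ⟧ N ∎

    codes≤L : (χ : Vec (Fin K) (#E G)) → length (codes χ) ≤ L
    codes≤L χ = begin
      length (codes χ) ≤⟨ length-codes χ ⟩
      #E G * K         ≤⟨ ℕ.*-monoˡ-≤ K (ℕ.≤-trans (length-encodeEnds (ends G))
                            (ℕ.≤-trans (ℕ.m≤n+m _ (suc (#V G))) (ℕ.≤-reflexive (sym N≡)))) ⟩
      N * K            ≤⟨ ℕ.*-monoʳ-≤ N (ℕ.m≤m+n K (N * 0)) ⟩
      L                ∎
      where open ℕ.≤-Reasoning

    padded : (χ : Vec (Fin K) (#E G)) →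
             ∃ λ j → toList (certificate L (codes χ)) ≡ codes χ ++ replicate j false
    padded χ = certificate-padding L (codes χ) (codes≤L χ)

    -- Sending a coloring to its padded code is the bijection. As the padding must consist of zeros,
    -- no coloring has a second accepted certificate.
    counts : IsEulerian K G → StronglyConnected G → Prime (#V G) →
             #NSC K G ≡ length (List.filterᵇ accepts (allBits L))
    counts (out , in′) connected pr = filter-bijection (nonSynchronizingColoring? G) (T? ∘ accepts)
      (allVecs-enumerates (Unique.allFin⁺ K , ∈-allFin) _) (allVecs-enumerates bits-enumerates L)
      (certificate L ∘ codes) injective sound onto
      where
      injective : ∀ {χ χ′} → certificate L (codes χ) ≡ certificate L (codes χ′) → χ ≡ χ′
      injective {χ} {χ′} eq = codes-injective χ χ′
        (trans (sym (proj₂ (padded χ))) (trans (cong toList eq) (proj₂ (padded χ′))))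
      sound : ∀ χ → NonSynchronizingColoring G χ → T (accepts (certificate L (codes χ)))
      sound χ nsc = Equivalence.from T-≡ (trans
        (cong (check initialCells (ends G)) (proj₂ (padded χ)))
        (check-complete initialCells (ends G) χ (proj₁ (padded χ))
          (latin⇒fits (ends G) χ (nonSynchronizing⇒latin G χ in′ connected pr nsc))))
      onto : ∀ y → T (accepts y) →
             ∃ λ χ → NonSynchronizingColoring G χ × certificate L (codes χ) ≡ y
      onto y accepted
        with χ , j , fits , eq ← check-sound initialCells (ends G) (toList y)
                                   (Equivalence.to T-≡ accepted) =
        χ , latin⇒nonSynchronizing G χ out pr (fits⇒latin (ends G) χ fits) ,
        certificate-unique y (codes χ) j eq

  nonSynchronizing∈#P : InSharpP (NonSynchronizingProblem K)
  nonSynchronizing∈#P = record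
    { verifier   = machine
    ; certLength = certLength
    ; timeBound  = timeBound
    ; accepts    = λ (G , _) → accepts G
    ; decides    = λ (G , _) y → let open Finishes (decides G y) in time , tapes , computes , within
    ; counts     = λ (G , eulerian , connected , pr) → counts G eulerian connected pr
    }

proposition5p9 : (k : ℕ) → 3 ≤ k →
    SharpPHard (OneFactorizationProblem k) →
    SharpPHard (NonSynchronizingProblem k) ×
    SharpPComplete (NonSynchronizingProblem k)
proposition5p9 (suc κ) _ hard = nsc-hard , Verifier.nonSynchronizing∈#P κ , nsc-hard
  where
  nsc-hard : SharpPHard (NonSynchronizingProblem (suc κ))
  nsc-hard = nonSynchronizing-hard (suc κ) hard
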